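{- For every positive integer $n$, each of the following $45$ statistics $f:S_n\to\mathbb{Z}$ is homomesic with respect to the Lehmer code rotation $\mathcal{L}$ acting on $S_n$ (that is, for each statistic there is a constant $c$, possibly depending on $n$, such that the average of $f$ over every orbit of $\mathcal{L}$ equals $c$). Here $\sigma=\sigma_1\cdots\sigma_n\in S_n$. Statistics related to inversions: (1) the number of inversions $\mathrm{inv}(\sigma)$; (2) the number of non-inversions, i.e. of pairs $i<j$ with $\sigma_i<\sigma_j$; (3) the number of inversions of distance at most $2$, i.e. inversions $(i,j)$ with $j-i\le 2$; (4) the number of inversions of the third entry, $\#\{j>3:\sigma_j<\sigma_3\}$; (5) the number of inversions of the second entry, $\#\{j>2:\sigma_j<\sigma_2\}$. Statistics related to descents: (6) the major index $\mathrm{maj}(\sigma)$; (7) the number of descents; (8) the number of (inner) peaks; (9) the number of left outer peaks; (10) the number of outer peaks; (11) the number of valleys including the boundary; (12) the number of ascents; (13) the number of (inner) valleys; (14) the number of double ascents; (15) the number of double descents; (16) the number of runs; (17) the number of times the permutation switches from increasing to decreasing or from decreasing to increasing; (18) the number of up-down runs; (19) the comajor index; (20) the number of right outer peaks; (21) the number of descents of distance $2$; (22) the number of ascents of distance $2$; (23) the number of odd descents; (24) the number of even descents. Statistics related to patterns: (25)–(30) for each of the six vincular patterns $21\text{ - }3$, $13\text{ - }2$, $12\text{ - }3$, $31\text{ - }2$, $23\text{ - }1$, $32\text{ - }1$, the number of its occurrences; (31) the number of occurrences of $123$ plus the number of occurrences of $132$; (32) the number of occurrences of $213$ plus the number of occurrences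 of $231$; (33) the number of occurrences of $312$ plus the number of occurrences of $321$; (34) the number of occurrences of $14\text{ - }2\text{ - }3$ or $14\text{ - }3\text{ - }2$; (35) the number of occurrences of the vincular pattern $|1\text{ - }23$. Other statistics: (36) the number of right-to-left maxima; (37) the rank of $\sigma$; (38) the first entry $\sigma_1$; (39) the width of the permutation tree of $\sigma$; (40) the Babson–Steingrímsson statistic $\mathrm{stat}$; (41) the Babson–Steingrímsson statistic $\mathrm{stat}'$; (42) the number of right-to-left minima; (43) $\mathrm{maj}(\sigma)-\mathrm{inv}(\sigma)$; (44) $\mathrm{inv}(\sigma)+\mathrm{maj}(\sigma)$; (45) the number of ascent tops $i$ such that all values smaller than $\sigma_i$ appear before position $i$.
   Context: Homomesy: given a finite set $S$, a bijection $\mathcal{X}:S\to S$ and $f:S\to\mathbb{Z}$, the triple is $c$-mesic (homomesic) if for every orbit $\mathcal{O}$ of $\mathcal{X}$, $\frac{1}{|\mathcal{O}|}\sum_{x\in\mathcal{O}}f(x)=c$. Permutations $\sigma\in S_n$ are written in one-line notation $\sigma_1\cdots\sigma_n$. The Lehmer code of $\sigma$ is $L(\sigma)=(L(\sigma)_1,\dots,L(\sigma)_n)$ with $L(\sigma)_i=\#\{j>i:\sigma_j<\sigma_i\}\in\{0,\dots,n-i\}$; this is a bijection between $S_n$ and such tuples. The Lehmer code rotation $\mathcal{L}:S_n\to S_n$ sends $\sigma$ to the unique $\tau$ with $L(\tau)_i\equiv L(\sigma)_i+1 \pmod{n-i+1}$, $L(\tau)_i\in\{0,\dots,n-i\}$,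 for all $i$. An inversion is a pair of positions $(i,j)$, $i<j$, with $\sigma_i>\sigma_j$. Index $i\in[n-1]$ is a descent if $\sigma_i>\sigma_{i+1}$ and an ascent otherwise. A peak (inner peak) is an index $i$ that is an ascent with $i+1$ a descent; a valley (inner valley) is an index $i$ that is a descent with $i+1$ an ascent. A double ascent is $i$ with $\sigma_i<\sigma_{i+1}<\sigma_{i+2}$; a double descent is $i$ with $\sigma_i>\sigma_{i+1}>\sigma_{i+2}$. A left outer peak is a peak, or the index $1$ if $1$ is a descent; a right outer peak is a peak, or the index $n-1$ if $n-1$ is an ascent; the number of outer peaks is the number of peaks plus $1$ if $1$ is a descent plus $1$ if $n-1$ is an ascent. The number of valleys including the boundary is the number of valleys, plus $1$ if $1$ is an ascent, plus $1$ if $n-1$ is a descent. The number of switches between increasing and decreasing is the number of peaks plus the number of valleys. The number of up-down runs is the number of maximal monotone contiguous subsequences, counting additionally the first entry alone if $1$ is a descent (equivalently, $1+\#\text{peaks}+\#\text{valleys}+[\sigma_1>\sigma_2]$). $\mathrm{maj}(\sigma)=\sum_{i\text{ descent}} i$; the comajor index is $\sum_{i \text{ descent}}(n-i)$. A run is a maximal contiguous increasing subsequence. A descent of distance $2$ is $i\in[n-2]$ with $\sigma_i>\sigma_{i+2}$, otherwise $i$ is an ascent of distance $2$. Odd (even) descents are descents $i$ with $i$ odd (even). An ascent top is a position $i\ge2$ with $\sigma_{i-1}<\sigma_i$. An occurrence of a classical pattern $abc$ is a triple of positions $i_1<i_2<i_3$ with $\sigma_{i_1}\sigma_{i_2}\sigma_{i_3}$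 in the same relative order as $abc$. An occurrence of the vincular pattern $ab\text{ - }c$ is such an occurrence with $i_2=i_1+1$; of $a\text{ - }bc$, one with $i_3=i_2+1$. An occurrence of $14\text{ - }2\text{ - }3$ or $14\text{ - }3\text{ - }2$ is a set of positions $i,i+1,\ell,m$ with $i+1<\ell<m$ and $\sigma_i<\sigma_\ell,\sigma_m<\sigma_{i+1}$. An occurrence of $|1\text{ - }23$ is an occurrence of $123$ at positions $1,2,k$. A right-to-left maximum (minimum) is an entry $\sigma_i$ larger (smaller) than all $\sigma_j$ with $j>i$. The rank of $\sigma$ is its position (from $1$ to $n!$) among all permutations of $[n]$ in lexicographic order. The permutation tree of $\sigma$ is the rooted tree on $\{0,\dots,n\}$ with root $0$ in which $\sigma_1$ is a child of the root and, for each $i$, $\sigma_{i+1}$ is attached as a child of the first node smaller than $\sigma_{i+1}$ on the path from $\sigma_i$ to the root; its width is its number of leaves. The Babson–Steingrímsson statistic $\mathrm{stat}$ is the total number of occurrences of $13\text{ - }2$, $21\text{ - }3$, $32\text{ - }1$ plus the number of descents; $\mathrm{stat}'$ is the total number of occurrences of $13\text{ - }2$, $31\text{ - }2$, $32\text{ - }1$ plus the number of descents. -}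

module Defs where

open import Data.Bool using (Bool; true; false; _∧_; _∨_; not; if_then_else_)
open import Data.Nat using (ℕ; zero; suc; _+_; _*_; _∸_; _<_; _≤_; _<ᵇ_; _≡ᵇ_; _%_)
open import Data.Integer as ℤ using (ℤ; +_)
open import Data.List using (List; []; _∷_; map; foldr; applyUpTo; length; concatMap)
open import Data.Nat.ListAction using (sum)
open import Data.List.Relation.Binary.Permutation.Propositional using (_↭_)
open import Data.Vec using (Vec; []; _∷_)
open import Data.Rational using (ℚ; _/_)
open import Data.Product using (∃; _×_)
open import Relation.Binary.PropositionalEquality using (_≡_; _≢_)

-- the interval [a, b] = a, a+1, ..., b  (empty if b < a)
range : ℕ → ℕ → List ℕ
range a b = applyUpTo (λ k → a + k) (suc b ∸ a)

[_] : Bool → ℕ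
[ true ]  = 1
[ false ] = 0

Σ[_⋯_] : ℕ → ℕ → (ℕ → ℕ) → ℕ
Σ[ a ⋯ b ] f = sum (map f (range a b))

All[_⋯_] : ℕ → ℕ → (ℕ → Bool) → Bool
All[ a ⋯ b ] p = foldr (λ i r → p i ∧ r) true (range a b)

_==_ : Bool → Bool → Bool
true  == b = b
false == b = not b

_∈ᵇ_ : ℕ → List ℕ → Bool
x ∈ᵇ [] = false
x ∈ᵇ (y ∷ ys) = (x ≡ᵇ y) ∨ (x ∈ᵇ ys)

sumℤ : List ℤ → ℤ
sumℤ = foldr ℤ._+_ (+ 0)

-- Permutations in one-line notation: σ = σ₁ ⋯ σₙ is a list of naturals
-- which is a rearrangement of 1, 2, ..., n.

IsPerm : ℕ → List ℕ → Set
IsPerm n σ = σ ↭ range 1 n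

-- σᵢ (1-based; positions outside [1, length σ] give the dummy value 0,
-- which is never used by the statistics below)
at : List ℕ → ℕ → ℕ
at []       _             = 0
at (x ∷ xs) zero          = 0
at (x ∷ xs) (suc zero)    = x
at (x ∷ xs) (suc (suc i)) = at xs (suc i)

lehmerAt : ℕ → List ℕ → ℕ → ℕ
lehmerAt n σ i = Σ[ suc i ⋯ n ] (λ j → [ at σ j <ᵇ at σ i ])

lehmer : ℕ → List ℕ → List ℕ
lehmer n σ = map (lehmerAt n σ) (range 1 n)

nth : ℕ → List ℕ → ℕ
nth _       []       = 0
nth zero    (x ∷ xs) = x
nth (suc k) (x ∷ xs) = nth k xs

removeAt : ℕ → List ℕ → List ℕ
removeAt _       []       = []
removeAt zero    (x ∷ xs) = xs
removeAt (suc k) (x ∷ xs) = x ∷ removeAt k xs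

-- decoding a Lehmer code: σᵢ is the (L(σ)ᵢ + 1)-th smallest value
-- not among σ₁,…,σᵢ₋₁  (the inverse of the Lehmer code bijection)
decodeFrom : List ℕ → List ℕ → List ℕ
decodeFrom rem []       = []
decodeFrom rem (c ∷ cs) = nth c rem ∷ decodeFrom (removeAt c rem) cs

decodeLehmer : ℕ → List ℕ → List ℕ
decodeLehmer n c = decodeFrom (range 1 n) c

rotateCode : ℕ → List ℕ → List ℕ
rotateCode n c = map (λ i → (nth (i ∸ 1) c + 1) % suc (n ∸ i)) (range 1 n)

lehmerRotation : ℕ → List ℕ → List ℕ
lehmerRotation n σ = decodeLehmer n (rotateCode n (lehmer n σ))

iter : {A : Set} → ℕ → (A → A) → A → A
iter zero    g x = x
iter (suc k) g x = g (iter k g x)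

IsOrbitSize : ℕ → List ℕ → ℕ → Set
IsOrbitSize n σ k =
  (0 < k) × (iter k (lehmerRotation n) σ ≡ σ)
  × (∀ j → 0 < j → j < k → iter j (lehmerRotation n) σ ≢ σ)

orbitSum : ℕ → (ℕ → List ℕ → ℤ) → List ℕ → ℕ → ℤ
orbitSum n f σ k = sumℤ (map (λ j → f n (iter j (lehmerRotation n) σ)) (range 0 (k ∸ 1)))

-- A statistic is a function f n : S_n → ℤ (n is passed explicitly).
-- (S_n, 𝓛, f n) is homomesic: there is c such that every orbit average is c.
Homomesic : ℕ → (ℕ → List ℕ → ℤ) → Set
Homomesic n f = ∃ λ (c : ℚ) → ∀ σ → IsPerm n σ → ∀ m →
  IsOrbitSize n σ (suc m) → orbitSum n f σ (suc m) / suc m ≡ c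

isDes : ℕ → List ℕ → ℕ → Bool
isDes n σ i = (0 <ᵇ i) ∧ (i <ᵇ n) ∧ (at σ (suc i) <ᵇ at σ i)

isAsc : ℕ → List ℕ → ℕ → Bool
isAsc n σ i = (0 <ᵇ i) ∧ (i <ᵇ n) ∧ (at σ i <ᵇ at σ (suc i))

isPeak : ℕ → List ℕ → ℕ → Bool
isPeak n σ i = isAsc n σ i ∧ isDes n σ (suc i)

isValley : ℕ → List ℕ → ℕ → Bool
isValley n σ i = isDes n σ i ∧ isAsc n σ (suc i)

odd : ℕ → Bool
odd i = (i % 2) ≡ᵇ 1

sameOrder : ℕ → ℕ → ℕ → ℕ → ℕ → ℕ → Bool
sameOrder a b c x y z =
  ((a <ᵇ b) == (x <ᵇ y)) ∧ ((b <ᵇ a) == (y <ᵇ x)) ∧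
  ((a <ᵇ c) == (x <ᵇ z)) ∧ ((c <ᵇ a) == (z <ᵇ x)) ∧
  ((b <ᵇ c) == (y <ᵇ z)) ∧ ((c <ᵇ b) == (z <ᵇ y))

Stat : Set
Stat = ℕ → List ℕ → ℕ

inv : Stat
inv n σ = Σ[ 1 ⋯ n ] λ i → Σ[ suc i ⋯ n ] λ j → [ at σ j <ᵇ at σ i ]

noninv : Stat
noninv n σ = Σ[ 1 ⋯ n ] λ i → Σ[ suc i ⋯ n ] λ j → [ at σ i <ᵇ at σ j ]

invDist≤2 : Stat
invDist≤2 n σ = Σ[ 1 ⋯ n ] λ i → Σ[ suc i ⋯ n ] λ j →
  [ (at σ j <ᵇ at σ i) ∧ (j ∸ i <ᵇ 3) ]

invOfEntry : ℕ → Stat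
invOfEntry p n σ = Σ[ suc p ⋯ n ] λ j → [ at σ j <ᵇ at σ p ]

maj : Stat
maj n σ = Σ[ 1 ⋯ n ∸ 1 ] λ i → i * [ isDes n σ i ]

des : Stat
des n σ = Σ[ 1 ⋯ n ∸ 1 ] λ i → [ isDes n σ i ]

asc : Stat
asc n σ = Σ[ 1 ⋯ n ∸ 1 ] λ i → [ isAsc n σ i ]

peaks : Stat
peaks n σ = Σ[ 1 ⋯ n ∸ 1 ] λ i → [ isPeak n σ i ]

valleys : Stat
valleys n σ = Σ[ 1 ⋯ n ∸ 1 ] λ i → [ isValley n σ i ]

leftOuterPeaks : Stat
leftOuterPeaks n σ = peaks n σ + [ isDes n σ 1 ]

rightOuterPeaks : Stat
rightOuterPeaks n σ = peaks n σ + [ isAsc n σ (n ∸ 1) ]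

outerPeaks : Stat
outerPeaks n σ = peaks n σ + [ isDes n σ 1 ] + [ isAsc n σ (n ∸ 1) ]

valleysBoundary : Stat
valleysBoundary n σ = valleys n σ + [ isAsc n σ 1 ] + [ isDes n σ (n ∸ 1) ]

doubleAsc : Stat
doubleAsc n σ = Σ[ 1 ⋯ n ∸ 2 ] λ i →
  [ (at σ i <ᵇ at σ (i + 1)) ∧ (at σ (i + 1) <ᵇ at σ (i + 2)) ]

doubleDes : Stat
doubleDes n σ = Σ[ 1 ⋯ n ∸ 2 ] λ i →
  [ (at σ (i + 1) <ᵇ at σ i) ∧ (at σ (i + 2) <ᵇ at σ (i + 1)) ]

-- runs (maximal contiguous increasing subsequences), counted by their
-- starting positions: i = 1, or i-1 is a descent
runs : Stat
runs n σ = Σ[ 1 ⋯ n ] λ i → [ (i ≡ᵇ 1) ∨ isDes n σ (i ∸ 1) ]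

switches : Stat
switches n σ = peaks n σ + valleys n σ

upDownRuns : Stat
upDownRuns n σ = 1 + peaks n σ + valleys n σ + [ isDes n σ 1 ]

comaj : Stat
comaj n σ = Σ[ 1 ⋯ n ∸ 1 ] λ i → (n ∸ i) * [ isDes n σ i ]

desDist2 : Stat
desDist2 n σ = Σ[ 1 ⋯ n ∸ 2 ] λ i → [ at σ (i + 2) <ᵇ at σ i ]

ascDist2 : Stat
ascDist2 n σ = Σ[ 1 ⋯ n ∸ 2 ] λ i → [ at σ i <ᵇ at σ (i + 2) ]

oddDes : Stat
oddDes n σ = Σ[ 1 ⋯ n ∸ 1 ] λ i → [ isDes n σ i ∧ odd i ]

evenDes : Stat
evenDes n σ = Σ[ 1 ⋯ n ∸ 1 ] λ i → [ isDes n σ i ∧ not (odd i) ]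

classical : ℕ → ℕ → ℕ → Stat
classical a b c n σ =
  Σ[ 1 ⋯ n ] λ i → Σ[ suc i ⋯ n ] λ j → Σ[ suc j ⋯ n ] λ k →
  [ sameOrder a b c (at σ i) (at σ j) (at σ k) ]

vincularAB-C : ℕ → ℕ → ℕ → Stat
vincularAB-C a b c n σ =
  Σ[ 1 ⋯ n ] λ i → Σ[ i + 2 ⋯ n ] λ k →
  [ sameOrder a b c (at σ i) (at σ (i + 1)) (at σ k) ]

occ14-2-3or14-3-2 : Stat
occ14-2-3or14-3-2 n σ =
  Σ[ 1 ⋯ n ] λ i → Σ[ i + 2 ⋯ n ] λ l → Σ[ suc l ⋯ n ] λ m →
  [ (at σ i <ᵇ at σ l) ∧ (at σ l <ᵇ at σ (i + 1)) ∧
    (at σ i <ᵇ at σ m) ∧ (at σ m <ᵇ at σ (i + 1)) ]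

occ|1-23 : Stat
occ|1-23 n σ = Σ[ 3 ⋯ n ] λ k →
  [ sameOrder 1 2 3 (at σ 1) (at σ 2) (at σ k) ]

rlMaxima : Stat
rlMaxima n σ = Σ[ 1 ⋯ n ] λ i → [ All[ suc i ⋯ n ] (λ j → at σ j <ᵇ at σ i) ]

rlMinima : Stat
rlMinima n σ = Σ[ 1 ⋯ n ] λ i → [ All[ suc i ⋯ n ] (λ j → at σ i <ᵇ at σ j) ]

allLists : ℕ → ℕ → List (List ℕ)
allLists n zero    = [] ∷ []
allLists n (suc k) = concatMap (λ v → map (v ∷_) (allLists n k)) (range 1 n)

isPermᵇ : ℕ → List ℕ → Bool
isPermᵇ n τ = (length τ ≡ᵇ n) ∧ All[ 1 ⋯ n ] (λ v → v ∈ᵇ τ)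

lexLeq : List ℕ → List ℕ → Bool
lexLeq []       _        = true
lexLeq (x ∷ xs) []       = false
lexLeq (x ∷ xs) (y ∷ ys) = (x <ᵇ y) ∨ ((x ≡ᵇ y) ∧ lexLeq xs ys)

-- rank σ = #{ τ ∈ S_n : τ ≤_lex σ }  (so the identity has rank 1)
rank : Stat
rank n σ = sum (map (λ τ → [ isPermᵇ n τ ∧ lexLeq τ σ ]) (allLists n n))

firstEntry : Stat
firstEntry n σ = at σ 1

-- permutation tree: the parent of each σᵢ₊₁ is the first node smaller than
-- σᵢ₊₁ on the path from σᵢ to the root 0.  'path' is that path (σᵢ first).
dropGreater : ℕ → List ℕ → List ℕ
dropGreater v []       = []
dropGreater v (x ∷ xs) = if v <ᵇ x then dropGreater v xs else x ∷ xs

headOr0 : List ℕ → ℕ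
headOr0 []      = 0
headOr0 (x ∷ _) = x

parentsFrom : List ℕ → List ℕ → List ℕ
parentsFrom path []       = []
parentsFrom path (v ∷ vs) =
  headOr0 (dropGreater v path) ∷ parentsFrom (v ∷ dropGreater v path) vs

treeParents : List ℕ → List ℕ
treeParents σ = parentsFrom (0 ∷ []) σ

-- width = number of leaves among the nodes {0, …, n}
treeWidth : Stat
treeWidth n σ = Σ[ 0 ⋯ n ] λ v → [ not (v ∈ᵇ treeParents σ) ]

bsStat : Stat
bsStat n σ = vincularAB-C 1 3 2 n σ + vincularAB-C 2 1 3 n σ
           + vincularAB-C 3 2 1 n σ + des n σ

bsStat' : Stat
bsStat' n σ = vincularAB-C 1 3 2 n σ + vincularAB-C 3 1 2 n σ
            + vincularAB-C 3 2 1 n σ + des n σ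

-- ascent tops i (σᵢ₋₁ < σᵢ) such that every value smaller than σᵢ
-- appears before position i
specialAscTops : Stat
specialAscTops n σ = Σ[ 2 ⋯ n ] λ i →
  [ (at σ (i ∸ 1) <ᵇ at σ i) ∧ All[ suc i ⋯ n ] (λ j → at σ i <ᵇ at σ j) ]

Statℤ : Set
Statℤ = ℕ → List ℕ → ℤ

ι : Stat → Statℤ
ι f n σ = + f n σ

statistics : Vec Statℤ 45
statistics =
  ι inv ∷ ι noninv ∷ ι invDist≤2 ∷ ι (invOfEntry 3) ∷ ι (invOfEntry 2) ∷
  ι maj ∷ ι des ∷ ι peaks ∷ ι leftOuterPeaks ∷ ι outerPeaks ∷
  ι valleysBoundary ∷ ι asc ∷ ι valleys ∷ ι doubleAsc ∷ ι doubleDes ∷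
  ι runs ∷ ι switches ∷ ι upDownRuns ∷ ι comaj ∷ ι rightOuterPeaks ∷
  ι desDist2 ∷ ι ascDist2 ∷ ι oddDes ∷ ι evenDes ∷
  ι (vincularAB-C 2 1 3) ∷ ι (vincularAB-C 1 3 2) ∷ ι (vincularAB-C 1 2 3) ∷
  ι (vincularAB-C 3 1 2) ∷ ι (vincularAB-C 2 3 1) ∷ ι (vincularAB-C 3 2 1) ∷
  ι (λ n σ → classical 1 2 3 n σ + classical 1 3 2 n σ) ∷
  ι (λ n σ → classical 2 1 3 n σ + classical 2 3 1 n σ) ∷
  ι (λ n σ → classical 3 1 2 n σ + classical 3 2 1 n σ) ∷
  ι occ14-2-3or14-3-2 ∷ ι occ|1-23 ∷
  ι rlMaxima ∷ ι rank ∷ ι firstEntry ∷ ι treeWidth ∷ ι bsStat ∷ ι bsStat' ∷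
  ι rlMinima ∷
  (λ n σ → + maj n σ ℤ.- + inv n σ) ∷
  ι (λ n σ → inv n σ + maj n σ) ∷
  ι specialAscTops ∷ []

{-# OPTIONS --safe #-}
module Submission where

-- Coordinate i of the Lehmer code is a residue modulo n − i + 1, and the rotation adds 1 to every
-- coordinate. Adjacent moduli are coprime, so along an orbit a coordinate, or a pair of adjacent
-- coordinates, is equidistributed; hence every statistic that is a sum of functions of adjacent
-- coordinates is homomesic. This covers all the statistics but those that involve the relative
-- order of σᵢ, σᵢ₊₁ and σᵢ₊₂, which reduce to counting σᵢ > σᵢ₊₁ > σᵢ₊₂ and σᵢ > σᵢ₊₂.
-- They depend on residues a, b, c modulo M + 2, M + 1 and M, where for even M the parity of a − c is
-- an invariant. Averaging over b, which is independent of (a, c), and then over one full turn of a,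
-- leaves a function of c, which the next turn shifts by 2. A reflection of c shows that both parity
-- classes have the same average.

open import Defs
open import Data.Bool using (Bool; true; false; _∧_; _∨_; not; if_then_else_; T)
open import Data.Bool.Properties using (∧-assoc; ∧-comm; ∧-zeroʳ; ∧-identityʳ)
open import Data.Nat using (ℕ; zero; suc; _+_; _*_; _∸_; _<_; _≤_; _<ᵇ_; _≡ᵇ_; _%_; _/_; z≤n; s≤s; z<s; s<s; s<s⁻¹; NonZero; _!)
open import Data.Nat.Properties
open import Data.Nat.DivMod
open import Data.Nat.Divisibility using (_∣_; divides; m%n≡0⇒n∣m; ∣-trans; m∣m*n; m≤n⇒m!∣n!)
open import Data.Nat.ListAction using (sum)
open import Data.Nat.ListAction.Properties using (sum-↭; sum-++)
open import Data.Nat.Tactic.RingSolver using (solve-∀)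
open import Data.Integer as ℤ using (ℤ) renaming (+_ to ↑_)
import Data.Integer.Properties as ℤ
import Data.Integer.Tactic.RingSolver as ℤSolver
import Data.Rational as ℚ
open import Data.Rational.Properties using (fromℚᵘ-cong)
open import Data.Rational.Unnormalised using (mkℚᵘ; *≡*)
open import Data.Fin using (Fin)
open import Data.List using (List; []; _∷_; _++_; map; foldr; applyUpTo; length; concatMap)
open import Data.List.Properties using (length-applyUpTo; map-applyUpTo; map-++; map-∘; ++-identityʳ)
open import Data.List.Membership.DecPropositional _≟_ using (_∈?_)
open import Data.List.Membership.Propositional using (_∈_)
open import Data.List.Membership.Propositional.Properties using (∈-∃++)
open import Data.List.Relation.Unary.All as All using (All; []; _∷_)
import Data.List.Relation.Unary.All.Properties as All
open import Data.List.Relation.Unary.AllPairs using (AllPairs; []; _∷_)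
import Data.List.Relation.Unary.AllPairs.Properties as AllPairs
open import Data.List.Relation.Unary.Any using (there)
open import Data.List.Relation.Unary.Unique.Propositional using (Unique)
import Data.List.Relation.Unary.Unique.Propositional.Properties as Unique
open import Data.List.Relation.Binary.Permutation.Propositional as ↭ using (_↭_; prep; swap; ↭-refl; ↭-trans; ↭-sym; ↭⇒↭ₛ)
open import Data.List.Relation.Binary.Permutation.Propositional.Properties using (map⁺; ↭-length; All-resp-↭; shift; ++⁺ʳ)
import Data.List.Relation.Binary.Permutation.Setoid.Properties as Permutationₛ
open import Data.Vec using (lookup)
open import Data.Vec.Relation.Unary.All as Vec using ([]; _∷_)
import Data.Vec.Relation.Unary.All.Properties as Vec
open import Data.Product using (∃; _×_; _,_)
open import Data.Empty using (⊥-elim)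
open import Function using (_∘_)
open import Relation.Nullary using (yes; no)
open import Relation.Nullary.Decidable using (False; toWitnessFalse)
open import Relation.Binary.PropositionalEquality hiding ([_])
open import Relation.Binary.PropositionalEquality.Properties using (setoid)
open import Algebra.Properties.CommutativeSemigroup +-commutativeSemigroup using (interchange)

-- Finite sums

-- Comparing σᵢ with σᵢ₊₁ amounts to comparing two adjacent code entries, and these two also
-- determine how many later values lie below, between or above σᵢ and σᵢ₊₁. This is why a pair of
-- coordinates suffices so often. With three coordinates the moduli M and M + 2 share the factor 2
-- when M is even, so that shifts of time do not reach all starting triples. The two exceptional
-- functions need reflections of different kinds. Let r be the value of c at the end of a turn of a.
-- For descending triples the turn contributes (1 + r) (M - r), which is invariant under r → M - 1 -
-- r; for even M this exchanges the parities. For σᵢ > σᵢ₊₂ the contributions of r and -r have a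
-- constant sum; this reflection preserves the parities, so that each class by itself averages to
-- half of the constant. Peaks, valleys and double ascents follow by complementation. All averages
-- are taken over one period common to all coordinates, so that homomesies can be added without
-- comparing orbit lengths; a double count returns to single orbits.

∑ : ℕ → (ℕ → ℕ) → ℕ
∑ zero    f = 0
∑ (suc n) f = f 0 + ∑ n (λ k → f (suc k))

∑-cong : ∀ n {f g : ℕ → ℕ} → (∀ k → k < n → f k ≡ g k) → ∑ n f ≡ ∑ n g
∑-cong zero    h = refl
∑-cong (suc n) h = cong₂ _+_ (h 0 z<s) (∑-cong n λ k k<n → h (suc k) (s<s k<n))

∑-ext : ∀ n {f g : ℕ → ℕ} → (∀ k → f k ≡ g k) → ∑ n f ≡ ∑ n g
∑-ext n h = ∑-cong n λ k _ → h k

∑-+ : ∀ n (f g : ℕ → ℕ) → ∑ n (λ k → f k + g k) ≡ ∑ n f + ∑ n g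
∑-+ zero    f g = refl
∑-+ (suc n) f g = trans (cong (f 0 + g 0 +_) (∑-+ n _ _)) (interchange (f 0) (g 0) _ _)

∑-const : ∀ n c → ∑ n (λ _ → c) ≡ n * c
∑-const zero    c = refl
∑-const (suc n) c = cong (c +_) (∑-const n c)

∑-zero : ∀ n → ∑ n (λ _ → 0) ≡ 0
∑-zero n = trans (∑-const n 0) (*-zeroʳ n)

∑-*ˡ : ∀ n c (f : ℕ → ℕ) → ∑ n (λ k → c * f k) ≡ c * ∑ n f
∑-*ˡ zero    c f = sym (*-zeroʳ c)
∑-*ˡ (suc n) c f = trans (cong (c * f 0 +_) (∑-*ˡ n c _)) (sym (*-distribˡ-+ c (f 0) _))

∑-swap : ∀ m n (f : ℕ → ℕ → ℕ) → ∑ m (λ i → ∑ n (f i)) ≡ ∑ n (λ j → ∑ m (λ i → f i j))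
∑-swap zero    n f = sym (∑-zero n)
∑-swap (suc m) n f = trans (cong (∑ n (f 0) +_) (∑-swap m n _)) (sym (∑-+ n (f 0) _))

∑-split : ∀ m n (f : ℕ → ℕ) → ∑ (m + n) f ≡ ∑ m f + ∑ n (λ k → f (m + k))
∑-split zero    n f = refl
∑-split (suc m) n f = trans (cong (f 0 +_) (∑-split m n _)) (sym (+-assoc (f 0) _ _))

∑-last : ∀ n (f : ℕ → ℕ) → ∑ (suc n) f ≡ ∑ n f + f n
∑-last zero    f = +-comm (f 0) 0
∑-last (suc n) f = trans (cong (f 0 +_) (∑-last n _)) (sym (+-assoc (f 0) _ _))

∑-reverse : ∀ n (f : ℕ → ℕ) → ∑ n f ≡ ∑ n (λ k → f (n ∸ suc k))
∑-reverse zero    f = refl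
∑-reverse (suc n) f =
  trans (∑-last n f) (trans (+-comm _ (f n)) (cong (f n +_) (∑-reverse n f)))

∑-blocks : ∀ k m (f : ℕ → ℕ) → ∑ (k * m) f ≡ ∑ k (λ j → ∑ m (λ a → f (j * m + a)))
∑-blocks zero    m f = refl
∑-blocks (suc k) m f = trans (∑-split m (k * m) f) (cong (∑ m f +_)
  (trans (∑-blocks k m _) (∑-ext k λ j → ∑-ext m λ a → cong f (sym (+-assoc m (j * m) a)))))

Periodic : ℕ → (ℕ → ℕ) → Set
Periodic p f = ∀ t → f (t + p) ≡ f t

Periodic-* : ∀ {p f} → Periodic p f → ∀ k → Periodic (k * p) f
Periodic-* {p} {f} per zero    t = cong f (+-identityʳ t)
Periodic-* {p} {f} per (suc k) t =
  trans (cong f (sym (+-assoc t p (k * p)))) (trans (Periodic-* per k (t + p)) (per t))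

-- Moving the window by one step trades its first term `f s` for `f (s + p)`, which is equal to it.
∑-shift : ∀ {p f} → Periodic p f → ∀ s → ∑ p (λ t → f (s + t)) ≡ ∑ p f
∑-shift {p} {f} per zero    = refl
∑-shift {p} {f} per (suc s) = trans
  (+-cancelˡ-≡ (f s) _ _ (begin
    f s + ∑ p (λ t → f (suc s + t))   ≡⟨ cong₂ _+_ (cong f (sym (+-identityʳ s))) (∑-ext p λ t → cong f (sym (+-suc s t))) ⟩
    ∑ (suc p) (λ t → f (s + t))       ≡⟨ ∑-last p _ ⟩
    ∑ p (λ t → f (s + t)) + f (s + p) ≡⟨ +-comm _ (f (s + p)) ⟩
    f (s + p) + ∑ p (λ t → f (s + t)) ≡⟨ cong (_+ ∑ p (λ t → f (s + t))) (per s) ⟩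
    f s + ∑ p (λ t → f (s + t))       ∎))
  (∑-shift per s)
  where open ≡-Reasoning

sum-map-applyUpTo : ∀ (f g : ℕ → ℕ) n → sum (map f (applyUpTo g n)) ≡ ∑ n (λ k → f (g k))
sum-map-applyUpTo f g zero    = refl
sum-map-applyUpTo f g (suc n) = cong (f (g 0) +_) (sum-map-applyUpTo f (λ k → g (suc k)) n)

Σ≡∑ : ∀ a b f → Σ[ a ⋯ b ] f ≡ ∑ (suc b ∸ a) (λ k → f (a + k))
Σ≡∑ a b f = sum-map-applyUpTo f (a +_) (suc b ∸ a)

∑-triangle : ∀ n → 2 * ∑ n (λ k → n ∸ k) ≡ n * suc n
∑-triangle zero    = refl
∑-triangle (suc n) = trans (*-distribˡ-+ 2 (suc n) _)
  (trans (cong (2 * suc n +_) (∑-triangle n)) (lemma n))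
  where
  lemma : ∀ n → 2 * suc n + n * suc n ≡ suc n * suc (suc n)
  lemma = solve-∀

-- Averages over the rotation of residues

-- A congruence is passed as an equation with an explicit multiple `k`, so that every use reduces to
-- a ring identity without subtraction.
%-shift : ∀ {x y} k m .{{_ : NonZero m}} → x ≡ y + k * m → ∀ t → (x + t) % m ≡ (y + t) % m
%-shift {x} {y} k m eq t = trans (cong (_% m) (trans (cong (_+ t) eq) (lemma y k m t)))
                                 ([m+kn]%n≡m%n (y + t) k m)
  where
  lemma : ∀ y k m t → y + k * m + t ≡ y + t + k * m
  lemma = solve-∀

%-periodic : ∀ {m p} .{{_ : NonZero m}} → m ∣ p → ∀ c t → (c + (t + p)) % m ≡ (c + t) % m
%-periodic {m} (divides k refl) c t =
  trans (cong (_% m) (sym (+-assoc c t (k * m)))) ([m+kn]%n≡m%n (c + t) k m)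

module _ (p : ℕ) where

  average₁ : ∀ m .{{_ : NonZero m}} → m ∣ p → (g : ℕ → ℕ) → ∀ α →
             ∑ p (λ t → g ((α + t) % m)) ≡ ∑ p (λ t → g (t % m))
  average₁ m m∣p g = ∑-shift λ t → cong g (%-periodic m∣p 0 t)

  -- Time s = β (1+m) + α m² is congruent to α modulo 1+m and to β modulo m.
  average₂ : ∀ m .{{_ : NonZero m}} → suc m ∣ p → m ∣ p → (g : ℕ → ℕ → ℕ) → ∀ α β →
             ∑ p (λ t → g ((α + t) % suc m) ((β + t) % m)) ≡ ∑ p (λ t → g (t % suc m) (t % m))
  average₂ (suc m) d₁ d₀ g α β = trans
    (∑-ext p λ t → cong₂ g (sym (%-shift (β + α * m) (2 + m) (lemma₁ α β m) t))
                           (sym (%-shift (α * suc m + β) (suc m) (lemma₀ α β m) t)))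
    (∑-shift (λ t → cong₂ g (%-periodic d₁ 0 t) (%-periodic d₀ 0 t))
             (β * (2 + m) + α * (suc m * suc m)))
    where
    lemma₁ : ∀ α β m → β * (2 + m) + α * (suc m * suc m) ≡ α + (β + α * m) * (2 + m)
    lemma₁ = solve-∀
    lemma₀ : ∀ α β m → β * (2 + m) + α * (suc m * suc m) ≡ β + (α * suc m + β) * suc m
    lemma₀ = solve-∀

<ᵇ-true : ∀ {m n} → m < n → (m <ᵇ n) ≡ true
<ᵇ-true {zero}  {suc n} _   = refl
<ᵇ-true {suc m} {suc n} m<n = <ᵇ-true {m} {n} (s<s⁻¹ m<n)

<ᵇ-false : ∀ {m n} → n ≤ m → (m <ᵇ n) ≡ false
<ᵇ-false {m}     {zero}  _   = refl
<ᵇ-false {suc m} {suc n} n≤m = <ᵇ-false {m} {n} (≤-pred n≤m)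

∧-falseʳ : ∀ b {c} → c ≡ false → b ∧ c ≡ false
∧-falseʳ true  refl = refl
∧-falseʳ false refl = refl

-- Three residues modulo `M + 2`, `M + 1` and `M`

module Reflection (μ q : ℕ) (f : ℕ → ℕ) (per : Periodic (suc μ) f) where

  private
    M = suc μ
    K = q * M

  -- One term for each turn of `a`, since a turn of `M + 2` steps moves a residue modulo `M` by 2.
  -- As `K` is a multiple of `M`, the progression closes up.
  Q : ℕ → ℕ
  Q y = ∑ K (λ j → f (y + 2 * j))

  Q-+2* : ∀ s y → Q (y + 2 * s) ≡ Q y
  Q-+2* s y = trans (∑-ext K λ j → cong f (lemma y s j)) (∑-shift {f = λ j → f (y + 2 * j)} per′ s)
    where
    lemma : ∀ y s j → y + 2 * s + 2 * j ≡ y + 2 * (s + j)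
    lemma = solve-∀
    lemma′ : ∀ y j q M → y + 2 * (j + q * M) ≡ y + 2 * j + 2 * q * M
    lemma′ = solve-∀
    per′ : Periodic K (λ j → f (y + 2 * j))
    per′ j = trans (cong f (lemma′ y j q M)) (Periodic-* per (2 * q) (y + 2 * j))

  Q-+*M : ∀ k y → Q (y + k * M) ≡ Q y
  Q-+*M k y = ∑-ext K λ j → trans (cong f (lemma y k M j)) (Periodic-* per k (y + 2 * j))
    where
    lemma : ∀ y k M j → y + k * M + 2 * j ≡ y + 2 * j + k * M
    lemma = solve-∀


  -- The reflection x → -1 - x carries the progression of `y` to that of 1 - y, which `y` further
  -- steps of 2 bring to 1 + y. For even `M` the two parity classes are exchanged.
  Q-suc : (∀ x y k → x + y + 1 ≡ k * M → f x ≡ f y) → ∀ y → Q y ≡ Q (suc y)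
  Q-suc symm y = begin
    -- Modulo `M`, `y * μ` is -y and `K ∸ suc j` is -1 - j. Each pair of arguments, plus one, adds
    -- up to exactly `(y + 2 * q) * M`.
    Q y                                             ≡⟨ ∑-cong K (λ j j<K → symm _ _ (y + 2 * q) (eq j j<K)) ⟩
    ∑ K (λ j → f (y * μ + 1 + 2 * (K ∸ suc j)))     ≡⟨ ∑-reverse K _ ⟨
    Q (y * μ + 1)                                   ≡⟨ Q-+2* y (y * μ + 1) ⟨
    Q (y * μ + 1 + 2 * y)                           ≡⟨ cong Q (lemma y μ) ⟩
    Q (suc y + y * M)                               ≡⟨ Q-+*M y (suc y) ⟩
    Q (suc y)                                       ∎
    where
    open ≡-Reasoning
    lemma : ∀ y μ → y * μ + 1 + 2 * y ≡ suc y + y * suc μ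
    lemma = solve-∀
    lemma′ : ∀ y μ j r → y + 2 * j + (y * μ + 1 + 2 * r) + 1 ≡ y * suc μ + 2 * (suc j + r)
    lemma′ = solve-∀
    lemma″ : ∀ y q M → y * M + 2 * (q * M) ≡ (y + 2 * q) * M
    lemma″ = solve-∀
    eq : ∀ j → j < K → y + 2 * j + (y * μ + 1 + 2 * (K ∸ suc j)) + 1 ≡ (y + 2 * q) * M
    eq j j<K = trans (lemma′ y μ j (K ∸ suc j))
      (trans (cong (λ z → y * M + 2 * z) (m+[n∸m]≡n j<K)) (lemma″ y q M))

  -- The reflection x → -x maps the progression of `y` to itself, so that the sum is paired with
  -- itself and its value is forced.
  Q-double : ∀ C → (∀ x y k → x + y ≡ k * M → f x + f y ≡ C) → ∀ y → 2 * Q y ≡ K * C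
  Q-double C symm y = begin
    2 * Q y                       ≡⟨ cong (Q y +_) (+-identityʳ (Q y)) ⟩
    Q y + Q y                     ≡⟨ cong (Q y +_) Qy≡ ⟩
    Q y + ∑ K (λ j → f (y * μ + 2 + 2 * (K ∸ suc j)))
                                  ≡⟨ ∑-+ K _ _ ⟨
    ∑ K (λ j → f (y + 2 * j) + f (y * μ + 2 + 2 * (K ∸ suc j)))
                                  ≡⟨ ∑-cong K (λ j j<K → symm _ _ (y + 2 * q) (eq j j<K)) ⟩
    ∑ K (λ _ → C)                 ≡⟨ ∑-const K C ⟩
    K * C                         ∎
    where
    open ≡-Reasoning
    lemma : ∀ y μ → y + 2 * 1 + y * suc μ ≡ y * μ + 2 + 2 * y
    lemma = solve-∀
    lemma′ : ∀ y μ j r → y + 2 * j + (y * μ + 2 + 2 * r) ≡ y * suc μ + 2 * (suc j + r)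
    lemma′ = solve-∀
    lemma″ : ∀ y q M → y * M + 2 * (q * M) ≡ (y + 2 * q) * M
    lemma″ = solve-∀
    eq : ∀ j → j < K → y + 2 * j + (y * μ + 2 + 2 * (K ∸ suc j)) ≡ (y + 2 * q) * M
    eq j j<K = trans (lemma′ y μ j (K ∸ suc j))
      (trans (cong (λ z → y * M + 2 * z) (m+[n∸m]≡n j<K)) (lemma″ y q M))
    Qy≡ : Q y ≡ ∑ K (λ j → f (y * μ + 2 + 2 * (K ∸ suc j)))
    Qy≡ = begin
      Q y                   ≡⟨ Q-+2* 1 y ⟨
      Q (y + 2 * 1)         ≡⟨ Q-+*M y (y + 2 * 1) ⟨
      Q (y + 2 * 1 + y * M) ≡⟨ cong Q (lemma y μ) ⟩
      Q (y * μ + 2 + 2 * y) ≡⟨ Q-+2* y (y * μ + 2) ⟩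
      Q (y * μ + 2)         ≡⟨ ∑-reverse K _ ⟩
      ∑ K (λ j → f (y * μ + 2 + 2 * (K ∸ suc j))) ∎

module ThreeResidues (μ q : ℕ) (g : ℕ → ℕ → ℕ → ℕ) where

  private
    M = suc μ
    K = q * M
    p = K * (2 + M)

  h : ℕ → ℕ → ℕ
  h a c = ∑ (suc M) (λ b → g a b c)

  -- One turn of `a` without the moment `a = 0`, at which `h` vanishes in the applications. Here `y`
  -- modulo `M` is the value of `c` both when `a = 1` and when `a = M + 1`.
  f : ℕ → ℕ
  f y = ∑ (suc M) (λ a → h (suc a) ((y + a) % M))

  f-periodic : Periodic M f
  f-periodic y = ∑-ext (suc M) λ a → cong (h (suc a)) (%-shift 1 M (cong (y +_) (sym (+-identityʳ M))) a)

  open Reflection μ q f f-periodic public using (Q; Q-suc; Q-double)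

  S : ℕ → ℕ → ℕ → ℕ
  S α β γ = ∑ p (λ t → g ((α + t) % (2 + M)) ((β + t) % suc M) ((γ + t) % M))

  module _ (d : suc M ∣ p) where

    private
      d₂ : 2 + M ∣ p
      d₂ = divides K refl
      d₀ : M ∣ p
      d₀ = divides (q * (2 + M)) (lemma q M)
        where
        lemma : ∀ q M → q * M * (2 + M) ≡ q * (2 + M) * M
        lemma = solve-∀

      cong₃ : ∀ {a a′ b b′ c c′} → a ≡ a′ → b ≡ b′ → c ≡ c′ → g a b c ≡ g a′ b′ c′
      cong₃ refl refl refl = refl

    S-shift : ∀ s α β γ → S (α + s) (β + s) (γ + s) ≡ S α β γ
    S-shift s α β γ = trans
      (∑-ext p λ t → cong₃ (cong (_% (2 + M)) (+-assoc α s t)) (cong (_% suc M) (+-assoc β s t)) (cong (_% M) (+-assoc γ s t)))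
      (∑-shift {f = λ t → g ((α + t) % (2 + M)) ((β + t) % suc M) ((γ + t) % M)}
        (λ t → cong₃ (%-periodic d₂ α t) (%-periodic d β t) (%-periodic d₀ γ t)) s)

    S-cong : ∀ {α α′ β β′ γ γ′} i j k → α ≡ α′ + i * (2 + M) → β ≡ β′ + j * suc M → γ ≡ γ′ + k * M →
             S α β γ ≡ S α′ β′ γ′
    S-cong i j k e₂ e₁ e₀ = ∑-ext p λ t →
      cong₃ (%-shift i (2 + M) e₂ t) (%-shift j (suc M) e₁ t) (%-shift k M e₀ t)

    -- The shift `s` solves the two congruences for the coprime moduli `M + 2` and `M + 1`. The
    -- third start is compensated by `s * μ`, which is -s modulo `M`.
    S-normalise : ∀ α β γ → ∃ λ γ′ → S α β γ ≡ S 0 0 γ′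
    S-normalise α β γ = γ + s * μ , trans
      (sym (S-cong (β + α * M) (α * suc M + β) s (lemma₂ α β M) (lemma₁ α β μ) (lemma₀ γ s μ)))
      (S-shift s 0 0 (γ + s * μ))
      where
      s = β * (2 + M) + α * (suc M * suc M)
      lemma₂ : ∀ α β M → β * (2 + M) + α * (suc M * suc M) ≡ α + (β + α * M) * (2 + M)
      lemma₂ = solve-∀
      lemma₁ : ∀ α β μ → β * (3 + μ) + α * ((2 + μ) * (2 + μ)) ≡ β + (α * (2 + μ) + β) * (2 + μ)
      lemma₁ = solve-∀
      lemma₀ : ∀ γ s μ → γ + s * μ + s ≡ γ + s * suc μ
      lemma₀ = solve-∀

    -- (M (M + 2))² vanishes modulo M and M + 2, and is 1 modulo M + 1.
    S-middle : ∀ b γ → S 0 b γ ≡ S 0 0 γ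
    S-middle b γ = trans
      (sym (S-cong (b * (M * M * (2 + M))) (b * ((μ * μ + 4 * μ + 2) * suc M)) (b * (M * (2 + M) * (2 + M)))
        (lemma₂ b M) (lemma₁ b μ) (lemma₀ γ b M)))
      (S-shift (b * (M * (2 + M) * (M * (2 + M)))) 0 0 γ)
      where
      lemma₂ : ∀ b M → b * (M * (2 + M) * (M * (2 + M))) ≡ b * (M * M * (2 + M)) * (2 + M)
      lemma₂ = solve-∀
      lemma₁ : ∀ b μ → b * ((1 + μ) * (3 + μ) * ((1 + μ) * (3 + μ))) ≡ b + b * ((μ * μ + 4 * μ + 2) * (2 + μ)) * (2 + μ)
      lemma₁ = solve-∀
      lemma₀ : ∀ γ b M → γ + b * (M * (2 + M) * (M * (2 + M))) ≡ γ + b * (M * (2 + M) * (2 + M)) * M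
      lemma₀ = solve-∀

    -- The start of the middle residue is immaterial by `S-middle`, so it may be summed over. At
    -- each moment `b` then runs through all residues, which leaves `h`.
    S-sum-middle : ∀ γ → suc M * S 0 0 γ ≡ ∑ p (λ t → h (t % (2 + M)) ((γ + t) % M))
    S-sum-middle γ = begin
      suc M * S 0 0 γ              ≡⟨ ∑-const (suc M) (S 0 0 γ) ⟨
      ∑ (suc M) (λ _ → S 0 0 γ)    ≡⟨ ∑-ext (suc M) (λ b → S-middle b γ) ⟨
      ∑ (suc M) (λ b → S 0 b γ)    ≡⟨ ∑-swap (suc M) p (λ b t → g (t % (2 + M)) ((b + t) % suc M) ((γ + t) % M)) ⟩
      ∑ p (λ t → ∑ (suc M) (λ b → g (t % (2 + M)) ((b + t) % suc M) ((γ + t) % M)))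
                                   ≡⟨ ∑-ext p (λ t → rotate t (λ b → g (t % (2 + M)) b ((γ + t) % M))) ⟩
      ∑ p (λ t → h (t % (2 + M)) ((γ + t) % M)) ∎
      where
      open ≡-Reasoning
      rotate : ∀ t (u : ℕ → ℕ) → ∑ (suc M) (λ b → u ((b + t) % suc M)) ≡ ∑ (suc M) u
      rotate t u = trans (∑-ext (suc M) λ b → cong (λ z → u (z % suc M)) (+-comm b t))
        (trans (average₁ (suc M) (suc M) (divides 1 (sym (+-identityʳ (suc M)))) u t)
               (∑-cong (suc M) λ b b<m → cong u (m<n⇒m%n≡m b<m)))

    -- Time is cut into turns of `a`. From one turn to the next `c` moves by `M + 2`, that is by 2;
    -- dropping `a = 0` starts each turn one step later, hence `suc γ`.
    S-blocks : (∀ c → h 0 c ≡ 0) → ∀ γ → suc M * S 0 0 γ ≡ Q (suc γ)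
    S-blocks h0 γ = trans (S-sum-middle γ) (trans (∑-blocks K (2 + M) _)
      (∑-ext K λ j → trans
        (∑-cong (2 + M) λ a a<m → cong₂ h
          (trans (cong (_% (2 + M)) (+-comm (j * (2 + M)) a)) (trans ([m+kn]%n≡m%n a j (2 + M)) (m<n⇒m%n≡m a<m)))
          (trans (cong (_% M) (lemma γ j M a)) ([m+kn]%n≡m%n (γ + 2 * j + a) j M)))
        (cong₂ _+_ (h0 _) (∑-ext (suc M) λ a → cong (λ z → h (suc a) (z % M)) (+-suc (γ + 2 * j) a)))))
      where
      lemma : ∀ γ j M a → γ + (j * (2 + M) + a) ≡ γ + 2 * j + a + j * M
      lemma = solve-∀

    S-constant : (∀ c → h 0 c ≡ 0) → (∀ y → Q y ≡ Q (suc y)) → ∀ α β γ → S α β γ ≡ S 0 0 0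
    S-constant h0 Q-const α β γ with γ′ , eq ← S-normalise α β γ = trans eq
      (*-cancelˡ-≡ _ _ (suc M) (trans (S-blocks h0 γ′) (trans (const (suc γ′)) (sym (trans (S-blocks h0 0) (const 1))))))
      where
      const : ∀ y → Q y ≡ Q 0
      const zero    = refl
      const (suc y) = trans (sym (Q-const y)) (const y)

  -- During the turn `c` climbs from `y % M` to `M − 1` in `d` values, then wraps to 0 and climbs
  -- back to `y % M`.
  f-split : ∀ y d → y % M + d ≡ M →
            f y ≡ ∑ d (λ a → h (suc a) (y % M + a)) + ∑ (suc (y % M)) (λ i → h (suc (d + i)) i)
  f-split y d eq = trans (cong (λ N → ∑ N (λ a → h (suc a) ((y + a) % M))) N≡) (trans (∑-split d (suc r) _)
    (cong₂ _+_
      (∑-cong d λ a a<d → cong (h (suc a)) (trans (reduce a)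
        (m<n⇒m%n≡m (<-≤-trans (+-monoʳ-< r a<d) (≤-reflexive eq)))))
      (∑-cong (suc r) λ i i≤r → cong (h (suc (d + i))) (trans (reduce (d + i))
        (trans (cong (_% M) (wrap i)) (trans ([m+n]%n≡m%n i M) (m<n⇒m%n≡m (≤-<-trans (≤-pred i≤r) (m%n<n y M)))))))))
    where
    r = y % M
    N≡ : suc M ≡ d + suc r
    N≡ = trans (cong suc (trans (sym eq) (+-comm r d))) (sym (+-suc d r))
    reduce : ∀ a → (y + a) % M ≡ (r + a) % M
    reduce = %-shift (y / M) M (m≡m%n+[m/n]*n y M)
    wrap : ∀ i → r + (d + i) ≡ i + M
    wrap i = trans (sym (+-assoc r d i)) (trans (cong (_+ i) eq) (+-comm M i))

residues-sum : ∀ M .{{_ : NonZero M}} x y e k → x + y + e ≡ k * M → M ∣ x % M + y % M + e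
residues-sum M x y e k eq = m%n≡0⇒n∣m _ M (begin
  (x % M + y % M + e) % M   ≡⟨ cong (_% M) (+-assoc (x % M) (y % M) e) ⟩
  (x % M + (y % M + e)) % M ≡⟨ %-shift (x / M) M (m≡m%n+[m/n]*n x M) (y % M + e) ⟨
  (x + (y % M + e)) % M     ≡⟨ cong (_% M) (lemma x (y % M) e) ⟩
  (y % M + (x + e)) % M     ≡⟨ %-shift (y / M) M (m≡m%n+[m/n]*n y M) (x + e) ⟨
  (y + (x + e)) % M         ≡⟨ cong (_% M) (trans (lemma′ y x e) eq) ⟩
  (k * M) % M               ≡⟨ m*n%n≡0 k M ⟩
  0                         ∎)
  where
  open ≡-Reasoning
  lemma : ∀ x y e → x + (y + e) ≡ y + (x + e)
  lemma = solve-∀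
  lemma′ : ∀ y x e → y + (x + e) ≡ x + y + e
  lemma′ = solve-∀

∑-below : ∀ a e → ∑ (a + e) (λ b → [ b <ᵇ a ]) ≡ a
∑-below a e = trans (∑-split a e _) (trans (cong₂ _+_
  (trans (∑-cong a λ b b<a → cong [_] (<ᵇ-true b<a)) (trans (∑-const a 1) (*-identityʳ a)))
  (trans (∑-ext e λ k → cong [_] (<ᵇ-false (m≤m+n a k))) (∑-zero e))) (+-identityʳ a))

∑-between : ∀ i d e → ∑ (suc i + (d + e)) (λ b → [ (b <ᵇ suc (d + i)) ∧ (i <ᵇ b) ]) ≡ d
∑-between i d e = trans (∑-split (suc i) (d + e) inside) (cong₂ _+_
  (trans (∑-cong (suc i) {inside} λ b b≤i → cong [_] (∧-falseʳ (b <ᵇ suc (d + i)) (<ᵇ-false (≤-pred b≤i)))) (∑-zero (suc i)))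
  (trans (∑-ext (d + e) λ k → cong [_] (reindex k)) (∑-below d e)))
  where
  inside : ℕ → ℕ
  inside b = [ (b <ᵇ suc (d + i)) ∧ (i <ᵇ b) ]
  reindex : ∀ k → ((suc i + k) <ᵇ suc (d + i)) ∧ (i <ᵇ (suc i + k)) ≡ (k <ᵇ d)
  reindex k rewrite <ᵇ-true (s≤s (m≤m+n i k)) | +-comm d i with k <? d
  ... | yes k<d rewrite <ᵇ-true (+-monoʳ-< i k<d) | <ᵇ-true k<d = refl
  ... | no  k≮d rewrite <ᵇ-false (+-monoʳ-≤ i (≮⇒≥ k≮d)) | <ᵇ-false (≮⇒≥ k≮d) = refl

-- The middle residue of a descending triple a > b > c ranges over a − c − 1 values; over one
-- turn of a, these add up to (1 + r) (M − r) if c = r at the end of the turn.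
module DescendingTriple (μ q : ℕ) where

  private M = suc μ

  open ThreeResidues μ q (λ a b c → [ (b <ᵇ a) ∧ (c <ᵇ b) ]) public

  -- Before the wrap `c` is at least the first residue minus one, and no `b` fits strictly between.
  -- After it the difference is always `d + 1`, which leaves `d` values of `b`.
  f-formula : ∀ y d → y % M + d ≡ M → f y ≡ suc (y % M) * d
  f-formula y d eq = trans (f-split y d eq) (cong₂ _+_
    (trans (∑-ext d λ a → trans (∑-ext (suc M) λ b → cong [_] (low a b)) (∑-zero (suc M))) (∑-zero d))
    (trans (∑-cong (suc r) {λ i → h (suc (d + i)) i} λ i i≤r →
      trans (cong (λ N → ∑ N (λ b → [ (b <ᵇ suc (d + i)) ∧ (i <ᵇ b) ])) (N≡ i (≤-pred i≤r))) (∑-between i d (r ∸ i)))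
           (∑-const (suc r) d)))
    where
    r = y % M
    low : ∀ a b → (b <ᵇ suc a) ∧ (r + a <ᵇ b) ≡ false
    low a b with b ≤? a
    ... | yes b≤a = ∧-falseʳ (b <ᵇ suc a) (<ᵇ-false (≤-trans b≤a (m≤n+m a r)))
    ... | no  b≰a rewrite <ᵇ-false (≰⇒> b≰a) = refl
    N≡ : ∀ i → i ≤ r → suc M ≡ suc i + (d + (r ∸ i))
    N≡ i i≤r = cong suc (trans (sym eq) (trans (cong (_+ d) (sym (m+[n∸m]≡n i≤r))) (lemma i (r ∸ i) d)))
      where
      lemma : ∀ i e d → i + e + d ≡ i + (d + e)
      lemma = solve-∀

  -- For the residues r and r′, the number r + r′ + 1 is a positive multiple of `M` below 2 M, hence
  -- `M` itself. The factors r + 1 and M - r of `f-formula` therefore trade places.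
  f-symmetric : ∀ x y k → x + y + 1 ≡ k * M → f x ≡ f y
  f-symmetric x y k eq = trans (f-formula x (suc r′) e₁) (trans (*-comm (suc r) (suc r′)) (sym (f-formula y (suc r) e₂)))
    where
    r = x % M
    r′ = y % M
    one : ∀ j → r + r′ + 1 ≡ j * M → r + r′ + 1 ≡ M
    one zero          e = ⊥-elim (1+n≢0 (trans (+-comm 1 (r + r′)) e))
    one (suc zero)    e = trans e (+-identityʳ M)
    one (suc (suc j)) e = ⊥-elim (<⇒≢ (begin-strict
      r + r′ + 1      ≡⟨ lemma r r′ ⟩
      r + suc r′      <⟨ +-mono-<-≤ (m%n<n x M) (m%n<n y M) ⟩
      M + M           ≤⟨ m≤m+n (M + M) (j * M) ⟩
      M + M + j * M   ≡⟨ +-assoc M M (j * M) ⟩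
      suc (suc j) * M ∎) e)
      where
      open ≤-Reasoning
      lemma : ∀ r r′ → r + r′ + 1 ≡ r + suc r′
      lemma = solve-∀
    total : r + r′ + 1 ≡ M
    total with divides j e ← residues-sum M x y 1 k eq = one j e
    e₁ : r + suc r′ ≡ M
    e₁ = trans (lemma r r′) total
      where
      lemma : ∀ r r′ → r + suc r′ ≡ r + r′ + 1
      lemma = solve-∀
    e₂ : r′ + suc r ≡ M
    e₂ = trans (lemma r r′) total
      where
      lemma : ∀ r r′ → r′ + suc r ≡ r + r′ + 1
      lemma = solve-∀

  constant : suc M ∣ q * M * (2 + M) → ∀ α β γ → S α β γ ≡ S 0 0 0
  constant d = S-constant d (λ _ → ∑-zero (suc M)) (Q-suc f-symmetric)

-- For σᵢ > σᵢ₊₂, one turn of a contributes (1 + r) (M + 1), plus M (M + 1) / 2 if r = 0, so that the turns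
-- ending in r and −r modulo M add up to a constant.
module DistanceTwo (μ q : ℕ) where

  private M = suc μ

  open ThreeResidues μ q (λ a b c → [ c <ᵇ (a ∸ [ b <ᵇ a ]) ]) public

  private
    high : ∀ d i b → d ≢ 0 → (i <ᵇ (suc (d + i) ∸ [ b <ᵇ suc (d + i) ])) ≡ true
    high d i b d≢0 with b <ᵇ suc (d + i)
    ... | true  = <ᵇ-true (+-monoˡ-< i (n≢0⇒n>0 d≢0))
    ... | false = <ᵇ-true (s≤s (m≤n+m i d))

    f-upper : ∀ y d → d ≢ 0 → ∑ (suc (y % M)) (λ i → h (suc (d + i)) i) ≡ suc (y % M) * suc M
    f-upper y d d≢0 = trans (∑-ext (suc (y % M)) λ i →
      trans (∑-ext (suc M) λ b → cong [_] (high d i b d≢0)) (trans (∑-const (suc M) 1) (*-identityʳ (suc M))))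
      (∑-const (suc (y % M)) (suc M))

  f-formula : ∀ y d → y % M ≢ 0 → d ≢ 0 → y % M + d ≡ M → f y ≡ suc (y % M) * suc M
  f-formula y d r≢0 d≢0 eq = trans (f-split y d eq) (cong₂ _+_
    (trans (∑-ext d λ a → trans (∑-ext (suc M) λ b → cong [_] (<ᵇ-false
      (≤-trans (m∸n≤m (suc a) [ b <ᵇ suc a ]) (+-monoˡ-≤ a (n≢0⇒n>0 r≢0))))) (∑-zero (suc M))) (∑-zero d))
    (f-upper y d d≢0))

  -- When the turn ends in 0, `c` is exactly one less than the first residue until it wraps, so the
  -- correction `[ b <ᵇ a ]` decides the test. This adds a triangular number, and doubling avoids
  -- its half.
  f-formula-zero : ∀ y → y % M ≡ 0 → 2 * f y ≡ (2 + M) * suc M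
  f-formula-zero y r≡0 = begin
    2 * f y                                     ≡⟨ cong (2 *_) (f-split y M (cong (_+ M) r≡0)) ⟩
    2 * (∑ M (λ a → h (suc a) (r + a)) + ∑ (suc r) (λ i → h (suc (M + i)) i))
                                                ≡⟨ cong (2 *_) (cong₂ _+_ (∑-cong M lower)
                                                     (trans (f-upper y M 1+n≢0) (cong (λ z → suc z * suc M) r≡0))) ⟩
    2 * (∑ M (λ a → M ∸ a) + 1 * suc M)         ≡⟨ *-distribˡ-+ 2 (∑ M (λ a → M ∸ a)) _ ⟩
    2 * ∑ M (λ a → M ∸ a) + 2 * (1 * suc M)     ≡⟨ cong (_+ 2 * (1 * suc M)) (∑-triangle M) ⟩
    M * suc M + 2 * (1 * suc M)                 ≡⟨ lemma M ⟩
    (2 + M) * suc M                             ∎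
    where
    open ≡-Reasoning
    r = y % M
    lemma : ∀ M → M * suc M + 2 * (1 * suc M) ≡ (2 + M) * suc M
    lemma = solve-∀
    complement : ∀ a b → [ a <ᵇ (suc a ∸ [ b <ᵇ suc a ]) ] + [ b <ᵇ suc a ] ≡ 1
    complement a b with b <ᵇ suc a
    ... | true  rewrite <ᵇ-false (≤-refl {a}) = refl
    ... | false rewrite <ᵇ-true (≤-refl {suc a}) = refl
    lower : ∀ a → a < M → h (suc a) (r + a) ≡ M ∸ a
    lower a a<M rewrite r≡0 = +-cancelʳ-≡ (suc a) _ _ (begin
      h (suc a) a + suc a                                ≡⟨ cong (h (suc a) a +_) (trans (cong (λ N → ∑ N (λ b → [ b <ᵇ suc a ])) (cong suc (sym (m+[n∸m]≡n (<⇒≤ a<M))))) (∑-below (suc a) (M ∸ a))) ⟨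
      h (suc a) a + ∑ (suc M) (λ b → [ b <ᵇ suc a ])      ≡⟨ ∑-+ (suc M) (λ b → [ a <ᵇ (suc a ∸ [ b <ᵇ suc a ]) ]) (λ b → [ b <ᵇ suc a ]) ⟨
      ∑ (suc M) (λ b → [ a <ᵇ (suc a ∸ [ b <ᵇ suc a ]) ] + [ b <ᵇ suc a ]) ≡⟨ ∑-ext (suc M) (complement a) ⟩
      ∑ (suc M) (λ _ → 1)                                ≡⟨ trans (∑-const (suc M) 1) (*-identityʳ (suc M)) ⟩
      suc M                                              ≡⟨ cong suc (m∸n+n≡m (<⇒≤ a<M)) ⟨
      suc (M ∸ a + a)                                    ≡⟨ +-suc (M ∸ a) a ⟨
      M ∸ a + suc a                                      ∎)

  -- The residues add up to `M` or are both 0. In the first case the factors `suc (x % M)` and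
  -- `suc (y % M)` add up to `2 + M`; in the second, the exceptional value is exactly half of the
  -- constant.
  f-antisymmetric : ∀ x y k → x + y ≡ k * M → f x + f y ≡ (2 + M) * suc M
  f-antisymmetric x y k eq with residues-sum M x y 0 k (trans (+-identityʳ (x + y)) eq)
  ... | divides zero e = *-cancelˡ-≡ _ _ 2 (begin
    2 * (f x + f y)     ≡⟨ *-distribˡ-+ 2 (f x) (f y) ⟩
    2 * f x + 2 * f y   ≡⟨ cong₂ _+_ (f-formula-zero x x0) (f-formula-zero y y0) ⟩
    (2 + M) * suc M + (2 + M) * suc M ≡⟨ cong ((2 + M) * suc M +_) (+-identityʳ _) ⟨
    2 * ((2 + M) * suc M) ∎)
    where
    open ≡-Reasoning
    x0 : x % M ≡ 0
    x0 = m+n≡0⇒m≡0 (x % M) (trans (sym (+-identityʳ _)) e)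
    y0 : y % M ≡ 0
    y0 = m+n≡0⇒n≡0 (x % M) (trans (sym (+-identityʳ _)) e)
  ... | divides (suc zero) e = begin
    f x + f y ≡⟨ cong₂ _+_ (f-formula x (y % M) x≢0 y≢0 e′) (f-formula y (x % M) y≢0 x≢0 (trans (+-comm (y % M) (x % M)) e′)) ⟩
    suc (x % M) * suc M + suc (y % M) * suc M ≡⟨ lemma (x % M) (y % M) M ⟩
    (2 + (x % M + y % M)) * suc M ≡⟨ cong (λ z → (2 + z) * suc M) e′ ⟩
    (2 + M) * suc M ∎
    where
    open ≡-Reasoning
    lemma : ∀ r r′ M → suc r * suc M + suc r′ * suc M ≡ (2 + (r + r′)) * suc M
    lemma = solve-∀
    e′ : x % M + y % M ≡ M
    e′ = trans (sym (+-identityʳ _)) (trans e (+-identityʳ M))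
    x≢0 : x % M ≢ 0
    x≢0 z = <⇒≢ (m%n<n y M) (trans (cong (_+ y % M) (sym z)) e′)
    y≢0 : y % M ≢ 0
    y≢0 z = <⇒≢ (m%n<n x M) (trans (sym (+-identityʳ (x % M))) (trans (cong (x % M +_) (sym z)) e′))
  ... | divides (suc (suc j)) e = ⊥-elim (<⇒≢ (begin-strict
    x % M + y % M + 0  ≡⟨ +-identityʳ _ ⟩
    x % M + y % M      <⟨ +-mono-< (m%n<n x M) (m%n<n y M) ⟩
    M + M              ≤⟨ m≤m+n (M + M) (j * M) ⟩
    M + M + j * M      ≡⟨ +-assoc M M (j * M) ⟩
    suc (suc j) * M    ∎) e)
    where open ≤-Reasoning

  constant : suc M ∣ q * M * (2 + M) → ∀ α β γ → S α β γ ≡ S 0 0 0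
  constant d = S-constant d (λ _ → ∑-zero (suc M)) λ y →
    *-cancelˡ-≡ _ _ 2 (trans (Q-double _ f-antisymmetric y) (sym (Q-double _ f-antisymmetric (suc y))))

-- The Lehmer code and its decoding

∑-at : ∀ (φ : ℕ → ℕ) xs → ∑ (length xs) (λ k → φ (at xs (suc k))) ≡ sum (map φ xs)
∑-at φ []       = refl
∑-at φ (x ∷ xs) = cong (φ x +_) (∑-at φ xs)

smaller : ℕ → List ℕ → ℕ
smaller x xs = sum (map (λ y → [ y <ᵇ x ]) xs)

smaller-↭ : ∀ {x xs ys} → xs ↭ ys → smaller x xs ≡ smaller x ys
smaller-↭ p = sum-↭ (map⁺ _ p)

code : List ℕ → List ℕ
code []       = []
code (x ∷ xs) = smaller x xs ∷ code xs

lehmerAt-∑ : ∀ n σ i → lehmerAt n σ i ≡ ∑ (n ∸ i) (λ k → [ at σ (suc i + k) <ᵇ at σ i ])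
lehmerAt-∑ n σ i = Σ≡∑ (suc i) n _

lehmerAt-code : ∀ xs i → i < length xs → lehmerAt (length xs) xs (suc i) ≡ at (code xs) (suc i)
lehmerAt-code (x ∷ xs) zero    _ = trans (lehmerAt-∑ (suc (length xs)) (x ∷ xs) 1) (∑-at (λ y → [ y <ᵇ x ]) xs)
lehmerAt-code (x ∷ xs) (suc i) p = trans (lehmerAt-∑ (suc (length xs)) (x ∷ xs) (2 + i))
  (trans (sym (lehmerAt-∑ (length xs) xs (suc i))) (lehmerAt-code xs i (s<s⁻¹ p)))

data Code : ℕ → List ℕ → Set where
  []  : Code 0 []
  _∷_ : ∀ {k c cs} → c ≤ k → Code k cs → Code (suc k) (c ∷ cs)

nth-removeAt-↭ : ∀ c xs → c < length xs → nth c xs ∷ removeAt c xs ↭ xs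
nth-removeAt-↭ zero    (x ∷ xs) _ = ↭-refl
nth-removeAt-↭ (suc c) (x ∷ xs) p = ↭-trans (swap _ x ↭-refl) (prep x (nth-removeAt-↭ c xs (s<s⁻¹ p)))

removeAt-All : ∀ {P : ℕ → Set} c {xs} → All P xs → All P (removeAt c xs)
removeAt-All c       []         = []
removeAt-All zero    (px ∷ pxs) = pxs
removeAt-All (suc c) (px ∷ pxs) = px ∷ removeAt-All c pxs

removeAt-sorted : ∀ c {xs} → AllPairs _<_ xs → AllPairs _<_ (removeAt c xs)
removeAt-sorted c       []         = []
removeAt-sorted zero    (px ∷ pxs) = pxs
removeAt-sorted (suc c) (px ∷ pxs) = removeAt-All c px ∷ removeAt-sorted c pxs

nth-All : ∀ {P : ℕ → Set} c {xs} → c < length xs → All P xs → P (nth c xs)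
nth-All zero    _ (px ∷ pxs) = px
nth-All (suc c) p (px ∷ pxs) = nth-All c (s<s⁻¹ p) pxs

smaller-nth : ∀ c {xs} → c < length xs → AllPairs _<_ xs → smaller (nth c xs) (removeAt c xs) ≡ c
smaller-nth zero    _ (px ∷ pxs) = none px
  where
  none : ∀ {x xs} → All (x <_) xs → smaller x xs ≡ 0
  none []         = refl
  none (x<y ∷ ps) = cong₂ _+_ (cong [_] (<ᵇ-false (<⇒≤ x<y))) (none ps)
smaller-nth (suc c) p (px ∷ pxs) =
  cong₂ _+_ (cong [_] (<ᵇ-true (nth-All c (s<s⁻¹ p) px))) (smaller-nth c (s<s⁻¹ p) pxs)

length-removeAt : ∀ c xs {k} → c ≤ k → length xs ≡ suc k → length (removeAt c xs) ≡ k
length-removeAt c xs c≤k eq = suc-injective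
  (trans (↭-length (nth-removeAt-↭ c xs (subst (c <_) (sym eq) (s≤s c≤k)))) eq)

decodeFrom-↭ : ∀ {k cs} rem → length rem ≡ k → Code k cs → decodeFrom rem cs ↭ rem
decodeFrom-↭ []  eq []                 = ↭-refl
decodeFrom-↭ rem eq (_∷_ {k} {c} c≤k cs) = ↭-trans
  (prep _ (decodeFrom-↭ (removeAt c rem) (length-removeAt c rem c≤k eq) cs))
  (nth-removeAt-↭ c rem (subst (c <_) (sym eq) (s≤s c≤k)))

-- In a sorted list the chosen entry has exactly `c` smaller companions, and the entries decoded
-- afterwards are a rearrangement of those companions.
code-decodeFrom : ∀ {k cs} rem → length rem ≡ k → AllPairs _<_ rem → Code k cs → code (decodeFrom rem cs) ≡ cs
code-decodeFrom rem eq sorted []                 = refl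
code-decodeFrom rem eq sorted (_∷_ {k} {c} c≤k cs) = cong₂ _∷_
  (trans (smaller-↭ {nth c rem} (decodeFrom-↭ (removeAt c rem) eq′ cs))
         (smaller-nth c (subst (c <_) (sym eq) (s≤s c≤k)) sorted))
  (code-decodeFrom (removeAt c rem) eq′ (removeAt-sorted c sorted) cs)
  where eq′ = length-removeAt c rem c≤k eq

applyUpTo-Code : ∀ n (w : ℕ → ℕ) → (∀ k → k < n → w k < n ∸ k) → Code n (applyUpTo w n)
applyUpTo-Code zero    w h = []
applyUpTo-Code (suc n) w h = ≤-pred (h 0 z<s) ∷ applyUpTo-Code n (w ∘ suc) (λ k k<n → h (suc k) (s<s k<n))

at-applyUpTo : ∀ n (w : ℕ → ℕ) i → i < n → at (applyUpTo w n) (suc i) ≡ w i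
at-applyUpTo (suc n) w zero    _ = refl
at-applyUpTo (suc n) w (suc i) p = at-applyUpTo n (w ∘ suc) i (s<s⁻¹ p)

nth-applyUpTo : ∀ n (w : ℕ → ℕ) i → i < n → nth i (applyUpTo w n) ≡ w i
nth-applyUpTo (suc n) w zero    _ = refl
nth-applyUpTo (suc n) w (suc i) p = nth-applyUpTo n (w ∘ suc) i (s<s⁻¹ p)

range-sorted : ∀ n → AllPairs _<_ (range 1 n)
range-sorted n = AllPairs.applyUpTo⁺₁ suc n (λ i<j _ → s<s i<j)

length-range : ∀ n → length (range 1 n) ≡ n
length-range n = length-applyUpTo suc n

rotatedEntry : ℕ → List ℕ → ℕ → ℕ
rotatedEntry n cs k = (nth k cs + 1) % suc (n ∸ suc k)

rotateCode≡applyUpTo : ∀ n cs → rotateCode n cs ≡ applyUpTo (rotatedEntry n cs) n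
rotateCode≡applyUpTo n cs = map-applyUpTo suc _ n

rotateCode-Code : ∀ n cs → Code n (rotateCode n cs)
rotateCode-Code n cs = subst (Code n) (sym (rotateCode≡applyUpTo n cs)) (applyUpTo-Code n _ λ k k<n →
  <-≤-trans (m%n<n (nth k cs + 1) (suc (n ∸ suc k))) (≤-reflexive (sym (+-∸-assoc 1 k<n))))

lehmerRotation-isPerm : ∀ n τ → IsPerm n (lehmerRotation n τ)
lehmerRotation-isPerm n τ = decodeFrom-↭ (range 1 n) (length-range n) (rotateCode-Code n (lehmer n τ))

IsPerm-length : ∀ {n σ} → IsPerm n σ → length σ ≡ n
IsPerm-length {n} p = trans (↭-length p) (length-range n)

lehmerAt-rotation : ∀ n τ i → 1 ≤ i → i ≤ n →
                    lehmerAt n (lehmerRotation n τ) i ≡ (lehmerAt n τ i + 1) % suc (n ∸ i)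
lehmerAt-rotation n τ (suc i) _ i<n = begin
  lehmerAt n τ′ (suc i)               ≡⟨ cong (λ m → lehmerAt m τ′ (suc i)) len ⟨
  lehmerAt (length τ′) τ′ (suc i)     ≡⟨ lehmerAt-code τ′ i (subst (i <_) (sym len) i<n) ⟩
  at (code τ′) (suc i)                ≡⟨ cong (λ c → at c (suc i)) (code-decodeFrom (range 1 n) (length-range n) (range-sorted n) (rotateCode-Code n cs)) ⟩
  at (rotateCode n cs) (suc i)        ≡⟨ cong (λ c → at c (suc i)) (rotateCode≡applyUpTo n cs) ⟩
  at (applyUpTo (rotatedEntry n cs) n) (suc i) ≡⟨ at-applyUpTo n _ i i<n ⟩
  (nth i cs + 1) % suc (n ∸ suc i)    ≡⟨ cong (λ c → (nth i c + 1) % suc (n ∸ suc i)) (map-applyUpTo suc (lehmerAt n τ) n) ⟩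
  (nth i (applyUpTo (λ k → lehmerAt n τ (suc k)) n) + 1) % suc (n ∸ suc i)
                                      ≡⟨ cong (λ c → (c + 1) % suc (n ∸ suc i)) (nth-applyUpTo n _ i i<n) ⟩
  (lehmerAt n τ (suc i) + 1) % suc (n ∸ suc i) ∎
  where
  open ≡-Reasoning
  τ′ = lehmerRotation n τ
  cs = lehmer n τ
  len = IsPerm-length (lehmerRotation-isPerm n τ)

∑-≤ : ∀ n (b : ℕ → Bool) → ∑ n (λ k → [ b k ]) ≤ n
∑-≤ zero    b = z≤n
∑-≤ (suc n) b with b 0
... | true  = s≤s (∑-≤ n _)
... | false = m≤n⇒m≤1+n (∑-≤ n _)

lehmerAt≤ : ∀ n σ i → lehmerAt n σ i ≤ n ∸ i
lehmerAt≤ n σ i = ≤-trans (≤-reflexive (lehmerAt-∑ n σ i)) (∑-≤ (n ∸ i) _)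

-- Homomesic statistics

m<n∸o⇒o+m<n : ∀ o n {m} → m < n ∸ o → o + m < n
m<n∸o⇒o+m<n zero    n       p = p
m<n∸o⇒o+m<n (suc o) (suc n) p = s<s (m<n∸o⇒o+m<n o n p)

m∣n! : ∀ {m n} → 1 ≤ m → m ≤ n → m ∣ n !
m∣n! {suc m} _ m≤n = ∣-trans (m∣m*n (m !)) (m≤n⇒m!∣n! m≤n)

iter-+ : ∀ {A : Set} (g : A → A) s t x → iter (s + t) g x ≡ iter s g (iter t g x)
iter-+ g zero    t x = refl
iter-+ g (suc s) t x = cong g (iter-+ g s t x)

/-cross : ∀ a b m q .{{_ : NonZero q}} → a ℤ.* ↑ q ≡ b ℤ.* ↑ suc m → a ℚ./ suc m ≡ b ℚ./ q
/-cross a b m (suc q) eq = fromℚᵘ-cong {mkℚᵘ a m} {mkℚᵘ b q} (*≡* eq)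

sumℤ-difference : ∀ k {F : ℕ → ℤ} {h f g : ℕ → ℕ} → (∀ j → F (h j) ≡ ↑ f j ℤ.- ↑ g j) →
                  sumℤ (map F (applyUpTo h k)) ≡ ↑ ∑ k f ℤ.- ↑ ∑ k g
sumℤ-difference zero    eq = refl
sumℤ-difference (suc k) {F} {h} {f} {g} eq = begin
  F (h 0) ℤ.+ sumℤ (map F (applyUpTo (h ∘ suc) k))
    ≡⟨ cong₂ ℤ._+_ (eq 0) (sumℤ-difference k (λ j → eq (suc j))) ⟩
  (↑ f 0 ℤ.- ↑ g 0) ℤ.+ (↑ ∑ k (f ∘ suc) ℤ.- ↑ ∑ k (g ∘ suc))
    ≡⟨ lemma (↑ f 0) (↑ g 0) (↑ ∑ k (f ∘ suc)) (↑ ∑ k (g ∘ suc)) ⟩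
  (↑ f 0 ℤ.+ ↑ ∑ k (f ∘ suc)) ℤ.- (↑ g 0 ℤ.+ ↑ ∑ k (g ∘ suc)) ∎
  where
  open ≡-Reasoning
  lemma : ∀ a b c d → (a ℤ.- b) ℤ.+ (c ℤ.- d) ≡ (a ℤ.+ c) ℤ.- (b ℤ.+ d)
  lemma = ℤSolver.solve-∀

module Rotation (n : ℕ) where

  -- With two factors `n !`, `M` can be split off one and `M + 2` off the other, which gives the
  -- form `q * M * (2 + M)` of the period in `ThreeResidues`.
  P : ℕ
  P = n ! * n !

  modulus∣P : ∀ {m} → 1 ≤ m → m ≤ n → m ∣ P
  modulus∣P 1≤m m≤n = ∣-trans (m∣n! 1≤m m≤n) (m∣m*n (n !))

  -- Only the codes modulo their moduli matter, and `start` is left unreduced: a later window of an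
  -- orbit is again a trajectory, with the elapsed time added to `start`.
  record Trajectory : Set where
    field
      perm   : ℕ → List ℕ
      isPerm : ∀ t → IsPerm n (perm t)
      start  : ℕ → ℕ
      lehmer-perm : ∀ t i → 1 ≤ i → i ≤ n → lehmerAt n (perm t) i ≡ (start i + t) % suc (n ∸ i)

  open Trajectory

  -- P is a period of the rotation, though in general not the least one, so Hom f says that the
  -- averages of f over all orbits coincide.
  record Hom (f : List ℕ → ℕ) : Set where
    constructor hom
    field
      {total}  : ℕ
      constant : ∀ T → ∑ P (λ t → f (perm T t)) ≡ total

  open Hom

  orbit : ∀ σ → IsPerm n σ → Trajectory
  orbit σ p = record
    { perm   = λ t → iter t (lehmerRotation n) σ
    ; isPerm = λ { zero → p ; (suc t) → lehmerRotation-isPerm n (iter t (lehmerRotation n) σ) }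
    ; start  = lehmerAt n σ
    ; lehmer-perm = codes
    }
    where
    codes : ∀ t i → 1 ≤ i → i ≤ n → lehmerAt n (iter t (lehmerRotation n) σ) i ≡ (lehmerAt n σ i + t) % suc (n ∸ i)
    codes zero    i _ _ = sym (trans (cong (_% suc (n ∸ i)) (+-identityʳ (lehmerAt n σ i))) (m≤n⇒m%n≡m (lehmerAt≤ n σ i)))
    codes (suc t) i 1≤i i≤n = begin
      lehmerAt n (lehmerRotation n (iter t (lehmerRotation n) σ)) i ≡⟨ lehmerAt-rotation n (iter t (lehmerRotation n) σ) i 1≤i i≤n ⟩
      (lehmerAt n (iter t (lehmerRotation n) σ) i + 1) % m          ≡⟨ cong (λ c → (c + 1) % m) (codes t i 1≤i i≤n) ⟩
      ((c + t) % m + 1) % m                                         ≡⟨ %-shift ((c + t) / m) m (m≡m%n+[m/n]*n (c + t) m) 1 ⟨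
      (c + t + 1) % m                                               ≡⟨ cong (_% m) (lemma c t) ⟩
      (c + suc t) % m                                               ∎
      where
      open ≡-Reasoning
      m = suc (n ∸ i)
      c = lehmerAt n σ i
      lemma : ∀ c t → c + t + 1 ≡ c + suc t
      lemma = solve-∀

  later : ℕ → Trajectory → Trajectory
  later s T = record
    { perm   = λ t → perm T (s + t)
    ; isPerm = λ t → isPerm T (s + t)
    ; start  = λ i → start T i + s
    ; lehmer-perm = λ t i 1≤i i≤n → trans (lehmer-perm T (s + t) i 1≤i i≤n)
                                          (cong (_% suc (n ∸ i)) (sym (+-assoc (start T i) s t)))
    }

  -- The sum over `P * k` steps is counted twice: as `P` passes through the cycle of length `k`, and
  -- as `k` windows of length `P`, each a trajectory of its own.
  Hom-orbitSum : ∀ {f} (h : Hom f) T k → (∀ t → perm T (t + k) ≡ perm T t) →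
                 P * ∑ k (λ t → f (perm T t)) ≡ k * total h
  Hom-orbitSum {f} h T k per = begin
    P * ∑ k F                             ≡⟨ ∑-const P _ ⟨
    ∑ P (λ _ → ∑ k F)                     ≡⟨ ∑-ext P (λ j → ∑-ext k λ a → sym (trans (cong F (+-comm (j * k) a)) (Periodic-* {f = F} (cong f ∘ per) j a))) ⟩
    ∑ P (λ j → ∑ k (λ a → F (j * k + a))) ≡⟨ ∑-blocks P k F ⟨
    ∑ (P * k) F                           ≡⟨ cong (λ N → ∑ N F) (*-comm P k) ⟩
    ∑ (k * P) F                           ≡⟨ ∑-blocks k P F ⟩
    ∑ k (λ j → ∑ P (λ a → F (j * P + a))) ≡⟨ ∑-ext k (λ j → constant h (later (j * P) T)) ⟩
    ∑ k (λ _ → total h)                   ≡⟨ ∑-const k (total h) ⟩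
    k * total h                           ∎
    where
    open ≡-Reasoning
    F : ℕ → ℕ
    F t = f (perm T t)

  -- The difference accommodates `maj − inv`, which may be negative; the other statistics take `g`
  -- to be zero.
  Hom⇒Homomesic : ∀ F {f g} → (∀ σ → F n σ ≡ ↑ f σ ℤ.- ↑ g σ) → Hom f → Hom g → Homomesic n F
  Hom⇒Homomesic F {f} {g} F≡ hf hg = (↑ total hf ℤ.- ↑ total hg) ℚ./ P , λ σ σ-perm m (_ , cycle , _) →
    let L = lehmerRotation n
        T = orbit σ σ-perm
        per : ∀ t → iter (t + suc m) L σ ≡ iter t L σ
        per t = trans (iter-+ L t (suc m) σ) (cong (iter t L) cycle)
        A = ∑ (suc m) (λ t → f (perm T t))
        B = ∑ (suc m) (λ t → g (perm T t))
    in trans (cong (ℚ._/ suc m) (sumℤ-difference (suc m) {h = λ j → j} {λ t → f (perm T t)} {λ t → g (perm T t)} (λ j → F≡ (perm T j))))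
             (/-cross (↑ A ℤ.- ↑ B) (↑ total hf ℤ.- ↑ total hg) m P
               (cross m A B (total hf) (total hg) (Hom-orbitSum hf T (suc m) per) (Hom-orbitSum hg T (suc m) per)))
    where
    instance
      P≢0 : NonZero P
      P≢0 = n !* n !≢0
    cross : ∀ m A B C D → P * A ≡ suc m * C → P * B ≡ suc m * D →
            (↑ A ℤ.- ↑ B) ℤ.* ↑ P ≡ (↑ C ℤ.- ↑ D) ℤ.* ↑ suc m
    cross m A B C D eA eB = begin
      (↑ A ℤ.- ↑ B) ℤ.* ↑ P               ≡⟨ lemma (↑ A) (↑ B) (↑ P) ⟩
      ↑ P ℤ.* ↑ A ℤ.- ↑ P ℤ.* ↑ B         ≡⟨ cong₂ ℤ._-_ (pos P A (suc m) C eA) (pos P B (suc m) D eB) ⟩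
      ↑ suc m ℤ.* ↑ C ℤ.- ↑ suc m ℤ.* ↑ D ≡⟨ lemma (↑ C) (↑ D) (↑ suc m) ⟨
      (↑ C ℤ.- ↑ D) ℤ.* ↑ suc m           ∎
      where
      open ≡-Reasoning
      lemma : ∀ a b p → (a ℤ.- b) ℤ.* p ≡ p ℤ.* a ℤ.- p ℤ.* b
      lemma = ℤSolver.solve-∀
      pos : ∀ a b c d → a * b ≡ c * d → ↑ a ℤ.* ↑ b ≡ ↑ c ℤ.* ↑ d
      pos a b c d e = trans (sym (ℤ.pos-* a b)) (trans (cong ↑_ e) (ℤ.pos-* c d))

  Hom-cong : ∀ {f g} → (∀ σ → IsPerm n σ → f σ ≡ g σ) → Hom g → Hom f
  Hom-cong eq hg = hom λ T → trans (∑-ext P λ t → eq (perm T t) (isPerm T t)) (constant hg T)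

  Hom-const : ∀ c → Hom (λ _ → c)
  Hom-const c = hom λ _ → ∑-const P c

  Hom-+ : ∀ {f g} → Hom f → Hom g → Hom (λ σ → f σ + g σ)
  Hom-+ hf hg = hom λ T → trans (∑-+ P _ _) (cong₂ _+_ (constant hf T) (constant hg T))

  Hom-* : ∀ c {f} → Hom f → Hom (λ σ → c * f σ)
  Hom-* c hf = hom λ T → trans (∑-*ˡ P c _) (cong (c *_) (constant hf T))

  -- Complements without subtraction at single permutations: only the totals over `P` steps are
  -- subtracted.
  Hom-cancel : ∀ {f g h} → (∀ σ → IsPerm n σ → f σ + g σ ≡ h σ) → Hom g → Hom h → Hom f
  Hom-cancel {f} {g} {h} eq hg hh = hom λ T →
    let F = ∑ P (λ t → f (perm T t))
        sums : F + total hg ≡ total hh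
        sums = trans (cong (F +_) (sym (constant hg T))) (trans (sym (∑-+ P _ _))
                 (trans (∑-ext P λ t → eq (perm T t) (isPerm T t)) (constant hh T)))
    in trans (sym (m+n∸n≡m F (total hg))) (cong (_∸ total hg) sums)

  Hom-∑ : ∀ k (f : ℕ → List ℕ → ℕ) → (∀ j → j < k → Hom (f j)) → Hom (λ σ → ∑ k (λ j → f j σ))
  Hom-∑ zero    f h = Hom-const 0
  Hom-∑ (suc k) f h = Hom-+ (h 0 z<s) (Hom-∑ k (f ∘ suc) (λ j j<k → h (suc j) (s<s j<k)))

  Hom-Σ : ∀ a b (f : ℕ → List ℕ → ℕ) → (∀ i → a ≤ i → i ≤ b → Hom (f i)) → Hom (λ σ → Σ[ a ⋯ b ] (λ i → f i σ))
  Hom-Σ a b f h = Hom-cong (λ σ _ → Σ≡∑ a b (λ i → f i σ)) (Hom-∑ (suc b ∸ a) (λ k → f (a + k)) λ k k< →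
    h (a + k) (m≤m+n a k) (≤-pred (m<n∸o⇒o+m<n a (suc b) k<)))

  Hom-code₁ : ∀ {i} → 1 ≤ i → i ≤ n → (g : ℕ → ℕ) → Hom (λ σ → g (lehmerAt n σ i))
  Hom-code₁ {i@(suc j)} 1≤i i≤n g = hom λ T → trans
    (∑-ext P λ t → cong g (lehmer-perm T t i 1≤i i≤n))
    (average₁ P (suc (n ∸ i)) (modulus∣P z<s m≤n) g (start T i))
    where
    m≤n : suc (n ∸ suc j) ≤ n
    m≤n = ≤-trans (≤-reflexive (sym (+-∸-assoc 1 i≤n))) (m∸n≤m n j)

  Hom-code₂ : ∀ {i} → 1 ≤ i → suc i ≤ n → (g : ℕ → ℕ → ℕ) → Hom (λ σ → g (lehmerAt n σ i) (lehmerAt n σ (suc i)))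
  Hom-code₂ {i@(suc j)} 1≤i i<n g = hom λ T → trans
    (∑-ext P λ t → cong₂ g (trans (lehmer-perm T t i 1≤i (<⇒≤ i<n)) (cong (λ m → (start T i + t) % suc m) m≡))
                           (lehmer-perm T t (suc i) z<s i<n))
    (average₂ P (suc (n ∸ suc i)) (modulus∣P z<s (≤-trans (≤-reflexive (cong suc (sym m≡))) m≤n))
      (modulus∣P z<s (≤-trans (≤-reflexive (sym m≡)) (m∸n≤m n i))) g (start T i) (start T (suc i)))
    where
    m≡ : n ∸ i ≡ suc (n ∸ suc i)
    m≡ = +-∸-assoc 1 i<n
    m≤n : suc (n ∸ i) ≤ n
    m≤n = ≤-trans (≤-reflexive (sym (+-∸-assoc 1 (<⇒≤ i<n)))) (m∸n≤m n j)

  -- Independence of the starts is a hypothesis on `g`: for even `M` it fails for general functions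
  -- of three coordinates, because of the parity invariant.
  Hom-code₃ : ∀ {i} → 1 ≤ i → 2 + i ≤ n → (g : ℕ → ℕ → ℕ → ℕ) →
    (∀ μ q → 2 + μ ∣ q * suc μ * (3 + μ) → ∀ α β γ → ThreeResidues.S μ q g α β γ ≡ ThreeResidues.S μ q g 0 0 0) →
    Hom (λ σ → g (lehmerAt n σ i) (lehmerAt n σ (suc i)) (lehmerAt n σ (2 + i)))
  Hom-code₃ {i@(suc j)} 1≤i i+2≤n g constant with m∣n! {suc (n ∸ (2 + i))} {n} z<s m₀≤n | m∣n! {3 + (n ∸ (2 + i))} {n} z<s m₂≤n
    where
    m₀≤n : suc (n ∸ (2 + i)) ≤ n
    m₀≤n = ≤-trans (≤-reflexive (sym (+-∸-assoc 1 i+2≤n))) (m∸n≤m n (suc i))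
    m₂≤n : 3 + (n ∸ (2 + i)) ≤ n
    m₂≤n = ≤-trans (≤-reflexive (sym (+-∸-assoc 3 i+2≤n))) (m∸n≤m n j)
  ... | divides u eq₀ | divides v eq₂ = hom λ T → trans
    (trans (∑-ext P λ t → cong₃ (trans (lehmer-perm T t i 1≤i (<⇒≤ (<⇒≤ i+2≤n))) (cong (λ m → (start T i + t) % suc m) (+-∸-assoc 2 i+2≤n)))
                                (trans (lehmer-perm T t (suc i) z<s (<⇒≤ i+2≤n)) (cong (λ m → (start T (suc i) + t) % suc m) (+-∸-assoc 1 i+2≤n)))
                                (lehmer-perm T t (2 + i) z<s i+2≤n))
           (cong (λ N → ∑ N (λ t → g ((start T i + t) % (3 + μ)) ((start T (suc i) + t) % (2 + μ)) ((start T (2 + i) + t) % suc μ))) P≡))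
    (constant μ (u * v) (subst (2 + μ ∣_) P≡ (modulus∣P z<s m₁≤n)) (start T i) (start T (suc i)) (start T (2 + i)))
    where
    μ = n ∸ (2 + i)
    m₁≤n : 2 + μ ≤ n
    m₁≤n = ≤-trans (≤-reflexive (sym (+-∸-assoc 2 i+2≤n))) (m∸n≤m n i)
    lemma : ∀ u a v b → u * a * (v * b) ≡ u * v * a * b
    lemma = solve-∀
    P≡ : P ≡ u * v * suc μ * (3 + μ)
    P≡ = trans (cong₂ _*_ eq₀ eq₂) (lemma u (suc μ) v (3 + μ))
    cong₃ : ∀ {a a′ b b′ c c′} → a ≡ a′ → b ≡ b′ → c ≡ c′ → g a b c ≡ g a′ b′ c′
    cong₃ refl refl refl = refl

-- Counting

<ᵇ-flip : ∀ {x y} → x ≢ y → (y <ᵇ x) ≡ not (x <ᵇ y)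
<ᵇ-flip {x} {y} x≢y with x <? y
... | yes x<y = trans (<ᵇ-false (<⇒≤ x<y)) (cong not (sym (<ᵇ-true x<y)))
... | no  x≮y = trans (<ᵇ-true (≤∧≢⇒< (≮⇒≥ x≮y) (x≢y ∘ sym))) (cong not (sym (<ᵇ-false (≮⇒≥ x≮y))))

[]-mono : ∀ a b → (a ≡ true → b ≡ true) → [ a ] ≤ [ b ]
[]-mono false b h = z≤n
[]-mono true  b h = ≤-reflexive (cong [_] (sym (h refl)))

<ᵇ⇒<′ : ∀ {m n} → (m <ᵇ n) ≡ true → m < n
<ᵇ⇒<′ {m} {n} eq = <ᵇ⇒< m n (subst T (sym eq) _)

<ᵇ-trans : ∀ x y z → (x <ᵇ y) ≡ true → (y <ᵇ z) ≡ true → (x <ᵇ z) ≡ true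
<ᵇ-trans x y z x<y y<z = <ᵇ-true (<-trans {x} {y} {z} (<ᵇ⇒<′ x<y) (<ᵇ⇒<′ y<z))

∑-mono : ∀ n {f g : ℕ → ℕ} → (∀ k → f k ≤ g k) → ∑ n f ≤ ∑ n g
∑-mono zero    h = z≤n
∑-mono (suc n) h = +-mono-≤ (h 0) (∑-mono n (λ k → h (suc k)))

∑-not : ∀ n (b : ℕ → Bool) → ∑ n (λ k → [ not (b k) ]) ≡ n ∸ ∑ n (λ k → [ b k ])
∑-not n b = trans (sym (m+n∸n≡m (∑ n (λ k → [ not (b k) ])) (∑ n (λ k → [ b k ]))))
  (cong (_∸ ∑ n (λ k → [ b k ])) (trans (sym (∑-+ n _ _))
    (trans (∑-ext n (λ k → one (b k))) (trans (∑-const n 1) (*-identityʳ n)))))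
  where
  one : ∀ b → [ not b ] + [ b ] ≡ 1
  one true  = refl
  one false = refl

-- If `s 0` is below `X`, then so is everything below `s 0`, and `s 0` itself makes the second count
-- larger. Otherwise everything below `X` is below `s 0`. Thus order relations can be read off from
-- counts.
first-below : ∀ N (s : ℕ → ℕ) X →
  (s 0 <ᵇ X) ≡ (∑ N (λ k → [ s (suc k) <ᵇ s 0 ]) <ᵇ ∑ (suc N) (λ k → [ s k <ᵇ X ]))
first-below N s X with s 0 <? X
... | yes s₀<X rewrite <ᵇ-true s₀<X = sym (<ᵇ-true (s≤s (∑-mono N λ k →
        []-mono _ _ λ sₖ<s₀ → <ᵇ-true (<-trans (<ᵇ⇒<′ sₖ<s₀) s₀<X))))
... | no  s₀≮X rewrite <ᵇ-false (≮⇒≥ s₀≮X) = sym (<ᵇ-false (∑-mono N λ k →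
        []-mono _ _ λ sₖ<X → <ᵇ-true (<-≤-trans (<ᵇ⇒<′ sₖ<X) (≮⇒≥ s₀≮X))))

-- Among `N` positions, `Q` lie in a set and `R` in a subset of it; the Booleans prescribe
-- membership in the set and in the subset, so that `false true` is impossible.
nestedCount : Bool → Bool → ℕ → ℕ → ℕ → ℕ
nestedCount true  true  N Q R = R
nestedCount true  false N Q R = Q ∸ R
nestedCount false true  N Q R = 0
nestedCount false false N Q R = N ∸ Q

∑-nested : ∀ β γ N (q r : ℕ → Bool) → (∀ k → k < N → r k ≡ true → q k ≡ true) →
  ∑ N (λ k → [ (β == q k) ∧ (γ == r k) ]) ≡ nestedCount β γ N (∑ N (λ k → [ q k ])) (∑ N (λ k → [ r k ]))
∑-nested true  true  N q r imp = ∑-cong N λ k k<N → cong [_] (absorb (q k) (r k) (imp k k<N))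
  where
  absorb : ∀ q r → (r ≡ true → q ≡ true) → q ∧ r ≡ r
  absorb true  r     _   = refl
  absorb false true  imp = imp refl
  absorb false false _   = refl
∑-nested true  false N q r imp = trans (sym (m+n∸n≡m _ (∑ N (λ k → [ r k ]))))
  (cong (_∸ ∑ N (λ k → [ r k ])) (trans (sym (∑-+ N (λ k → [ q k ∧ not (r k) ]) _))
    (∑-cong N λ k k<N → split (q k) (r k) (imp k k<N))))
  where
  split : ∀ q r → (r ≡ true → q ≡ true) → [ q ∧ not r ] + [ r ] ≡ [ q ]
  split true  true  _   = refl
  split true  false _   = refl
  split false false _   = refl
  split false true  imp with () ← imp refl
∑-nested false true  N q r imp = trans (∑-cong N λ k k<N → cong [_] (none (q k) (r k) (imp k k<N))) (∑-zero N)
  where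
  none : ∀ q r → (r ≡ true → q ≡ true) → not q ∧ r ≡ false
  none true  r     _   = refl
  none false false _   = refl
  none false true  imp with () ← imp refl
∑-nested false false N q r imp = trans (∑-cong N λ k k<N → cong [_] (absorb (q k) (r k) (imp k k<N))) (∑-not N q)
  where
  absorb : ∀ q r → (r ≡ true → q ≡ true) → not q ∧ not r ≡ not q
  absorb true  r     _   = refl
  absorb false false _   = refl
  absorb false true  imp with () ← imp refl

pairs : ℕ → (ℕ → ℕ → ℕ) → ℕ
pairs d u = ∑ d (λ k → ∑ (d ∸ suc k) (λ l → u k (suc k + l)))

pairs-cong : ∀ d {u v : ℕ → ℕ → ℕ} → (∀ k l → k < l → l < d → u k l ≡ v k l) → pairs d u ≡ pairs d v
pairs-cong d h = ∑-cong d λ k k<d → ∑-cong (d ∸ suc k) λ l l< →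
  h k (suc k + l) (s≤s (m≤m+n k l)) (m<n∸o⇒o+m<n (suc k) d l<)

pairs-+ : ∀ d (u v : ℕ → ℕ → ℕ) → pairs d (λ k l → u k l + v k l) ≡ pairs d u + pairs d v
pairs-+ d u v = trans (∑-ext d λ k → ∑-+ (d ∸ suc k) _ _) (∑-+ d _ _)

ΣΣ≡pairs : ∀ a n (w : ℕ → ℕ → ℕ) →
  (Σ[ a ⋯ n ] λ l → Σ[ suc l ⋯ n ] λ m → w l m) ≡ pairs (suc n ∸ a) (λ k l → w (a + k) (a + l))
ΣΣ≡pairs a n w = trans (Σ≡∑ a n _) (∑-ext (suc n ∸ a) λ k → trans (Σ≡∑ (suc (a + k)) n _)
  (trans (cong (λ N → ∑ N (λ l → w (a + k) (suc (a + k) + l)))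
           (trans (cong (suc n ∸_) (sym (+-suc a k))) (sym (∸-+-assoc (suc n) a (suc k)))))
         (∑-ext (suc n ∸ a ∸ suc k) λ l → cong (w (a + k)) (lemma a k l))))
  where
  lemma : ∀ a k l → suc (a + k) + l ≡ a + (suc k + l)
  lemma = solve-∀

choose₂ : ℕ → ℕ
choose₂ zero    = 0
choose₂ (suc m) = m + choose₂ m

pairs-both : ∀ d (b : ℕ → Bool) → pairs d (λ k l → [ b k ∧ b l ]) ≡ choose₂ (∑ d (λ k → [ b k ]))
pairs-both zero    b = refl
pairs-both (suc d) b with b 0
... | true  = cong (∑ d (λ k → [ b (suc k) ]) +_) (pairs-both d (b ∘ suc))
... | false = trans (cong (_+ pairs d (λ k l → [ b (suc k) ∧ b (suc l) ])) (∑-zero d)) (pairs-both d (b ∘ suc))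

-- The two summands cover both orders of a hit and a miss, so that the pairs correspond to a free
-- choice of one of each.
pairs-mixed : ∀ d (b : ℕ → Bool) → pairs d (λ k l → [ not (b k) ∧ b l ] + [ b k ∧ not (b l) ])
            ≡ ∑ d (λ k → [ b k ]) * ∑ d (λ k → [ not (b k) ])
pairs-mixed zero    b = refl
pairs-mixed (suc d) b with b 0
... | true  = cong (∑ d (λ k → [ not (b (suc k)) ]) +_) (pairs-mixed d (b ∘ suc))
... | false = trans (cong₂ _+_ (∑-ext d λ k → +-identityʳ [ b (suc k) ]) (pairs-mixed d (b ∘ suc)))
                    (sym (*-suc (∑ d (λ k → [ b (suc k) ])) (∑ d (λ k → [ not (b (suc k)) ]))))

-- A universal comparison becomes the vanishing of a count of failures, and such counts are what the
-- code records.
All-∑ : ∀ a b (p : ℕ → Bool) → All[ a ⋯ b ] p ≡ (∑ (suc b ∸ a) (λ k → [ not (p (a + k)) ]) ≡ᵇ 0)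
All-∑ a b p = go (suc b ∸ a) (a +_)
  where
  go : ∀ d (h : ℕ → ℕ) → foldr (λ i r → p i ∧ r) true (applyUpTo h d) ≡ (∑ d (λ k → [ not (p (h k)) ]) ≡ᵇ 0)
  go zero    h = refl
  go (suc d) h with p (h 0)
  ... | true  = go d (h ∘ suc)
  ... | false = refl

==-not : ∀ α p R → (α == p) ∧ ((not α == not p) ∧ R) ≡ (α == p) ∧ R
==-not true  true  R = refl
==-not true  false R = refl
==-not false true  R = refl
==-not false false R = refl

-- For distinct entries each reversed comparison is the negation of the direct one, in the pattern
-- and in the entries alike, and adds no condition.
sameOrder-distinct : ∀ a b c {x y z} → a ≢ b → a ≢ c → b ≢ c → x ≢ y → x ≢ z → y ≢ z →
  sameOrder a b c x y z ≡ ((a <ᵇ b) == (x <ᵇ y)) ∧ ((a <ᵇ c) == (x <ᵇ z)) ∧ ((b <ᵇ c) == (y <ᵇ z))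
sameOrder-distinct a b c {x} {y} {z} ab ac bc xy xz yz
  rewrite <ᵇ-flip ab | <ᵇ-flip ac | <ᵇ-flip bc | <ᵇ-flip xy | <ᵇ-flip xz | <ᵇ-flip yz
  = trans (==-not (a <ᵇ b) (x <ᵇ y) _) (cong ((a <ᵇ b) == (x <ᵇ y) ∧_)
    (trans (==-not (a <ᵇ c) (x <ᵇ z) _) (cong ((a <ᵇ c) == (x <ᵇ z) ∧_) (last (b <ᵇ c) (y <ᵇ z)))))
  where
  last : ∀ α p → (α == p) ∧ (not α == not p) ≡ (α == p)
  last true  true  = refl
  last true  false = refl
  last false true  = refl
  last false false = refl

-- Local statistics in terms of the code

Unique-↭ : ∀ {xs ys : List ℕ} → xs ↭ ys → Unique xs → Unique ys
Unique-↭ p = Permutationₛ.Unique-resp-↭ (setoid ℕ) (↭⇒↭ₛ p)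

at-All : ∀ {P : ℕ → Set} {xs} i → i < length xs → All P xs → P (at xs (suc i))
at-All zero    _ (px ∷ pxs) = px
at-All (suc i) p (px ∷ pxs) = at-All i (s<s⁻¹ p) pxs

at-distinct : ∀ {xs} → Unique xs → ∀ i j → i < j → j < length xs → at xs (suc i) ≢ at xs (suc j)
at-distinct (px ∷ pxs) zero    (suc j) _ p = at-All j (s<s⁻¹ p) px
at-distinct (px ∷ pxs) (suc i) (suc j) i<j p = at-distinct pxs i j (s<s⁻¹ i<j) (s<s⁻¹ p)

IsPerm-Unique : ∀ {n σ} → IsPerm n σ → Unique σ
IsPerm-Unique {n} p = Unique-↭ (↭-sym p) (Unique.applyUpTo⁺₁ suc n (λ i<j _ → <⇒≢ (s<s i<j)))

IsPerm-distinct : ∀ {n σ i j} → IsPerm n σ → 1 ≤ i → i < j → j ≤ n → at σ i ≢ at σ j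
IsPerm-distinct {i = suc i} {suc j} p _ i<j j≤n =
  at-distinct (IsPerm-Unique p) i j (s<s⁻¹ i<j) (≤-trans j≤n (≤-reflexive (sym (IsPerm-length p))))

module _ {n : ℕ} (σ : List ℕ) where

  private
    c : ℕ → ℕ
    c = lehmerAt n σ

  -- This is `first-below` for the entries after position `i`, with σᵢ as the bound.
  descent-code : ∀ {i} → suc i ≤ n → (at σ (suc i) <ᵇ at σ i) ≡ (c (suc i) <ᵇ c i)
  descent-code {i} i<n = begin
    (at σ (suc i) <ᵇ at σ i)
      ≡⟨ cong (λ j → at σ (suc j) <ᵇ at σ i) (+-identityʳ i) ⟨
    (s 0 <ᵇ at σ i)
      ≡⟨ first-below (n ∸ suc i) s (at σ i) ⟩
    (∑ (n ∸ suc i) (λ k → [ s (suc k) <ᵇ s 0 ]) <ᵇ ∑ (suc (n ∸ suc i)) (λ k → [ s k <ᵇ at σ i ]))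
      ≡⟨ cong₂ _<ᵇ_
           (trans (∑-ext (n ∸ suc i) λ k → cong₂ (λ x y → [ at σ x <ᵇ at σ (suc y) ]) (+-suc (suc i) k) (+-identityʳ i))
                  (sym (lehmerAt-∑ n σ (suc i))))
           (trans (cong (λ N → ∑ N (λ k → [ s k <ᵇ at σ i ])) (sym (+-∸-assoc 1 i<n))) (sym (lehmerAt-∑ n σ i))) ⟩
    (c (suc i) <ᵇ c i) ∎
    where
    open ≡-Reasoning
    s : ℕ → ℕ
    s k = at σ (suc i + k)

  -- Position `i + 1` is removed from the count `c i`; whether it was counted is itself visible in
  -- the code.
  below-code : ∀ {i} → suc i ≤ n →
    ∑ (n ∸ suc i) (λ k → [ at σ (2 + i + k) <ᵇ at σ i ]) ≡ c i ∸ [ c (suc i) <ᵇ c i ]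
  below-code {i} i<n = begin
    X                                             ≡⟨ m+n∸m≡n [ at σ (suc i) <ᵇ at σ i ] X ⟨
    [ at σ (suc i) <ᵇ at σ i ] + X ∸ [ at σ (suc i) <ᵇ at σ i ]
      ≡⟨ cong₂ _∸_ (sym total) (cong [_] (descent-code i<n)) ⟩
    c i ∸ [ c (suc i) <ᵇ c i ]                    ∎
    where
    open ≡-Reasoning
    X = ∑ (n ∸ suc i) (λ k → [ at σ (2 + i + k) <ᵇ at σ i ])
    total : c i ≡ [ at σ (suc i) <ᵇ at σ i ] + X
    total = trans (lehmerAt-∑ n σ i) (trans (cong (λ N → ∑ N (λ k → [ at σ (suc i + k) <ᵇ at σ i ])) (+-∸-assoc 1 i<n))
      (cong₂ _+_ (cong (λ j → [ at σ (suc j) <ᵇ at σ i ]) (+-identityʳ i))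
                 (∑-ext (n ∸ suc i) λ k → cong (λ j → [ at σ j <ᵇ at σ i ]) (+-suc (suc i) k))))

  -- Again `first-below`, now for the entries from position `i + 2` on. The count belonging to σᵢ
  -- must skip position `i + 1`, and this correction brings in the middle coordinate.
  distance2-code : ∀ {i} → 2 + i ≤ n → (at σ (2 + i) <ᵇ at σ i) ≡ (c (2 + i) <ᵇ (c i ∸ [ c (suc i) <ᵇ c i ]))
  distance2-code {i} i+2≤n = begin
    (at σ (2 + i) <ᵇ at σ i)
      ≡⟨ cong (λ j → at σ (2 + j) <ᵇ at σ i) (+-identityʳ i) ⟨
    (s 0 <ᵇ at σ i)
      ≡⟨ first-below (n ∸ (2 + i)) s (at σ i) ⟩
    (∑ (n ∸ (2 + i)) (λ k → [ s (suc k) <ᵇ s 0 ]) <ᵇ ∑ (suc (n ∸ (2 + i))) (λ k → [ s k <ᵇ at σ i ]))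
      ≡⟨ cong₂ _<ᵇ_
           (trans (∑-ext (n ∸ (2 + i)) λ k → cong₂ (λ x y → [ at σ x <ᵇ at σ (2 + y) ]) (+-suc (2 + i) k) (+-identityʳ i))
                  (sym (lehmerAt-∑ n σ (2 + i))))
           (trans (cong (λ N → ∑ N (λ k → [ s k <ᵇ at σ i ])) (sym (+-∸-assoc 1 i+2≤n))) (below-code (<⇒≤ i+2≤n))) ⟩
    (c (2 + i) <ᵇ (c i ∸ [ c (suc i) <ᵇ c i ])) ∎
    where
    open ≡-Reasoning
    s : ℕ → ℕ
    s k = at σ (2 + i + k)

-- The number of k ≥ i + 2 with (σᵢ < σₖ) = β and (σᵢ₊₁ < σₖ) = γ, where N = n − i − 1.
threeCount : Bool → Bool → ℕ → ℕ → ℕ → ℕ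
threeCount β γ N A B =
  if B <ᵇ A then nestedCount γ β N (N ∸ B) (N ∸ (A ∸ [ B <ᵇ A ])) else nestedCount β γ N (N ∸ (A ∸ [ B <ᵇ A ])) (N ∸ B)

module _ {n σ} (p : IsPerm n σ) where

  private
    c : ℕ → ℕ
    c = lehmerAt n σ

    inside : ∀ i k → k < n ∸ i → suc i + k ≤ n
    inside i k k< = m<n∸o⇒o+m<n i n k<

  ascent-code : ∀ {i} → 1 ≤ i → suc i ≤ n → (at σ i <ᵇ at σ (suc i)) ≡ not (c (suc i) <ᵇ c i)
  ascent-code {i} 1≤i i<n = trans (<ᵇ-flip (IsPerm-distinct p 1≤i ≤-refl i<n ∘ sym)) (cong not (descent-code σ i<n))

  above-code : ∀ {i} → 1 ≤ i → ∑ (n ∸ i) (λ k → [ at σ i <ᵇ at σ (suc i + k) ]) ≡ n ∸ i ∸ c i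
  above-code {i} 1≤i = trans
    (∑-cong (n ∸ i) λ k k< → cong [_] (<ᵇ-flip (IsPerm-distinct p 1≤i (s≤s (m≤m+n i k)) (inside i k k<) ∘ sym)))
    (trans (∑-not (n ∸ i) _) (cong (n ∸ i ∸_) (sym (lehmerAt-∑ n σ i))))

  above-later-code : ∀ {i} → 1 ≤ i → suc i ≤ n →
    ∑ (n ∸ suc i) (λ k → [ at σ i <ᵇ at σ (2 + i + k) ]) ≡ n ∸ suc i ∸ (c i ∸ [ c (suc i) <ᵇ c i ])
  above-later-code {i} 1≤i i<n = trans
    (∑-cong (n ∸ suc i) λ k k< → cong [_] (<ᵇ-flip
      (IsPerm-distinct p 1≤i (s≤s (≤-trans (n≤1+n i) (m≤m+n (suc i) k))) (inside (suc i) k k<) ∘ sym)))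
    (trans (∑-not (n ∸ suc i) _) (cong (n ∸ suc i ∸_) (below-code σ i<n)))

  -- The later values above σᵢ and those above σᵢ₊₁ form nested sets, the larger set belonging to
  -- the smaller entry. A descent at `i` therefore swaps the roles of `β` and `γ`.
  threeCount-code : ∀ {i} → 1 ≤ i → suc i ≤ n → ∀ β γ →
    ∑ (n ∸ suc i) (λ k → [ (β == (at σ i <ᵇ at σ (2 + i + k))) ∧ (γ == (at σ (suc i) <ᵇ at σ (2 + i + k))) ])
    ≡ threeCount β γ (n ∸ suc i) (c i) (c (suc i))
  threeCount-code {i} 1≤i i<n β γ = split (c (suc i) <ᵇ c i) refl
    where
    N = n ∸ suc i
    q r : ℕ → Bool
    q k = at σ i <ᵇ at σ (2 + i + k)
    r k = at σ (suc i) <ᵇ at σ (2 + i + k)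
    Q = N ∸ (c i ∸ [ c (suc i) <ᵇ c i ])
    R = N ∸ c (suc i)
    split : ∀ d → (c (suc i) <ᵇ c i) ≡ d →
      ∑ N (λ k → [ (β == q k) ∧ (γ == r k) ]) ≡ (if c (suc i) <ᵇ c i then nestedCount γ β N R Q else nestedCount β γ N Q R)
    split false eq = trans
      (∑-nested β γ N q r (λ k k<N rₖ → <ᵇ-trans (at σ i) (at σ (suc i)) (at σ (2 + i + k)) (trans (ascent-code 1≤i i<n) (cong not eq)) rₖ))
      (trans (cong₂ (nestedCount β γ N) (above-later-code 1≤i i<n) (above-code z<s))
             (cong (if_then nestedCount γ β N R Q else nestedCount β γ N Q R) (sym eq)))
    split true eq = trans (∑-ext N λ k → cong [_] (∧-comm (β == q k) (γ == r k))) (trans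
      (∑-nested γ β N r q (λ k k<N qₖ → <ᵇ-trans (at σ (suc i)) (at σ i) (at σ (2 + i + k)) (trans (descent-code σ i<n) eq) qₖ))
      (trans (cong₂ (nestedCount γ β N) (above-code z<s) (above-later-code 1≤i i<n))
             (cong (if_then nestedCount γ β N R Q else nestedCount β γ N Q R) (sym eq))))

-- Homomesies of local statistics

Σ-+ : ∀ a b (f g : ℕ → ℕ) → Σ[ a ⋯ b ] f + Σ[ a ⋯ b ] g ≡ Σ[ a ⋯ b ] (λ i → f i + g i)
Σ-+ a b f g = trans (cong₂ _+_ (Σ≡∑ a b f) (Σ≡∑ a b g)) (trans (sym (∑-+ (suc b ∸ a) _ _)) (sym (Σ≡∑ a b _)))

[]-∧ : ∀ a b → [ a ∧ b ] ≡ [ a ] * [ b ]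
[]-∧ true  b = sym (+-identityʳ [ b ])
[]-∧ false b = refl

[]-split : ∀ a b → [ not a ∧ b ] + [ a ∧ b ] ≡ [ b ]
[]-split true  b = refl
[]-split false b = +-identityʳ [ b ]

m≤n∸2⇒2+m≤n : ∀ {n m} → 1 ≤ m → m ≤ n ∸ 2 → 2 + m ≤ n
m≤n∸2⇒2+m≤n {n} {suc m} _ m≤n∸2 = m<n∸o⇒o+m<n 2 n m≤n∸2

module _ (n : ℕ) where

  open Rotation n

  Hom-descent : ∀ {i} → 1 ≤ i → suc i ≤ n → Hom (λ σ → [ at σ (suc i) <ᵇ at σ i ])
  Hom-descent 1≤i i<n = Hom-cong (λ σ _ → cong [_] (descent-code σ i<n)) (Hom-code₂ 1≤i i<n (λ a b → [ b <ᵇ a ]))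

  Hom-ascent : ∀ {i} → 1 ≤ i → suc i ≤ n → Hom (λ σ → [ at σ i <ᵇ at σ (suc i) ])
  Hom-ascent 1≤i i<n = Hom-cong (λ σ p → cong [_] (ascent-code p 1≤i i<n)) (Hom-code₂ 1≤i i<n (λ a b → [ not (b <ᵇ a) ]))

  Hom-doubleDescent : ∀ {i} → 1 ≤ i → 2 + i ≤ n →
    Hom (λ σ → [ (at σ (suc i) <ᵇ at σ i) ∧ (at σ (2 + i) <ᵇ at σ (suc i)) ])
  Hom-doubleDescent 1≤i i+2≤n = Hom-cong
    (λ σ _ → cong₂ (λ a b → [ a ∧ b ]) (descent-code σ (<⇒≤ i+2≤n)) (descent-code σ i+2≤n))
    (Hom-code₃ 1≤i i+2≤n (λ a b c → [ (b <ᵇ a) ∧ (c <ᵇ b) ]) DescendingTriple.constant)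

  -- A descent at `i + 1` follows either an ascent or a descent, so that peaks are what double
  -- descents leave of the descents.
  Hom-peak : ∀ {i} → 1 ≤ i → 2 + i ≤ n → Hom (λ σ → [ (at σ i <ᵇ at σ (suc i)) ∧ (at σ (2 + i) <ᵇ at σ (suc i)) ])
  Hom-peak {i} 1≤i i+2≤n = Hom-cancel
    (λ σ p → trans (cong (λ a → [ a ∧ (at σ (2 + i) <ᵇ at σ (suc i)) ] + [ (at σ (suc i) <ᵇ at σ i) ∧ (at σ (2 + i) <ᵇ at σ (suc i)) ])
                     (<ᵇ-flip (IsPerm-distinct p 1≤i ≤-refl (<⇒≤ i+2≤n) ∘ sym)))
                   ([]-split (at σ (suc i) <ᵇ at σ i) (at σ (2 + i) <ᵇ at σ (suc i))))
    (Hom-doubleDescent 1≤i i+2≤n) (Hom-descent z<s i+2≤n)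

  private
    second-flip : ∀ {σ i} → IsPerm n σ → 2 + i ≤ n → ∀ a →
      [ a ∧ (at σ (suc i) <ᵇ at σ (2 + i)) ] + [ a ∧ (at σ (2 + i) <ᵇ at σ (suc i)) ] ≡ [ a ]
    second-flip {σ} {i} p i+2≤n a = begin
      [ a ∧ u ] + [ a ∧ d ]     ≡⟨ cong (λ b → [ a ∧ b ] + [ a ∧ d ]) (<ᵇ-flip (IsPerm-distinct p z<s ≤-refl i+2≤n ∘ sym)) ⟩
      [ a ∧ not d ] + [ a ∧ d ] ≡⟨ cong₂ (λ b c → [ b ] + [ c ]) (∧-comm a (not d)) (∧-comm a d) ⟩
      [ not d ∧ a ] + [ d ∧ a ] ≡⟨ []-split d a ⟩
      [ a ]                     ∎
      where
      open ≡-Reasoning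
      u = at σ (suc i) <ᵇ at σ (2 + i)
      d = at σ (2 + i) <ᵇ at σ (suc i)

  Hom-valley : ∀ {i} → 1 ≤ i → 2 + i ≤ n → Hom (λ σ → [ (at σ (suc i) <ᵇ at σ i) ∧ (at σ (suc i) <ᵇ at σ (2 + i)) ])
  Hom-valley {i} 1≤i i+2≤n = Hom-cancel (λ σ p → second-flip p i+2≤n (at σ (suc i) <ᵇ at σ i))
    (Hom-doubleDescent 1≤i i+2≤n) (Hom-descent 1≤i (<⇒≤ i+2≤n))

  Hom-doubleAscent : ∀ {i} → 1 ≤ i → 2 + i ≤ n →
    Hom (λ σ → [ (at σ i <ᵇ at σ (suc i)) ∧ (at σ (suc i) <ᵇ at σ (2 + i)) ])
  Hom-doubleAscent {i} 1≤i i+2≤n = Hom-cancel (λ σ p → second-flip p i+2≤n (at σ i <ᵇ at σ (suc i)))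
    (Hom-peak 1≤i i+2≤n) (Hom-ascent 1≤i (<⇒≤ i+2≤n))

  Hom-descent2 : ∀ {i} → 1 ≤ i → 2 + i ≤ n → Hom (λ σ → [ at σ (2 + i) <ᵇ at σ i ])
  Hom-descent2 1≤i i+2≤n = Hom-cong (λ σ _ → cong [_] (distance2-code σ i+2≤n))
    (Hom-code₃ 1≤i i+2≤n (λ a b c → [ c <ᵇ (a ∸ [ b <ᵇ a ]) ]) DistanceTwo.constant)

  Hom-ascent2 : ∀ {i} → 1 ≤ i → 2 + i ≤ n → Hom (λ σ → [ at σ i <ᵇ at σ (2 + i) ])
  Hom-ascent2 {i} 1≤i i+2≤n = Hom-cancel
    (λ σ p → trans (cong (λ a → [ a ] + [ at σ (2 + i) <ᵇ at σ i ])
                     (<ᵇ-flip (IsPerm-distinct p 1≤i (s≤s (n≤1+n i)) i+2≤n ∘ sym)))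
                   (one (at σ (2 + i) <ᵇ at σ i)))
    (Hom-descent2 1≤i i+2≤n) (Hom-const 1)
    where
    one : ∀ b → [ not b ] + [ b ] ≡ 1
    one true  = refl
    one false = refl

  Hom-isDes : ∀ i → Hom (λ σ → [ isDes n σ i ])
  Hom-isDes zero    = Hom-const 0
  Hom-isDes (suc i) with suc i <? n
  ... | yes i<n rewrite <ᵇ-true i<n = Hom-descent z<s i<n
  ... | no  i≮n rewrite <ᵇ-false (≮⇒≥ i≮n) = Hom-const 0

  Hom-isAsc : ∀ i → Hom (λ σ → [ isAsc n σ i ])
  Hom-isAsc zero    = Hom-const 0
  Hom-isAsc (suc i) with suc i <? n
  ... | yes i<n rewrite <ᵇ-true i<n = Hom-ascent z<s i<n
  ... | no  i≮n rewrite <ᵇ-false (≮⇒≥ i≮n) = Hom-const 0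

  Hom-isPeak : ∀ i → Hom (λ σ → [ isPeak n σ i ])
  Hom-isPeak zero    = Hom-const 0
  Hom-isPeak (suc i) with 2 + i <? n
  ... | yes i<n rewrite <ᵇ-true i<n | <ᵇ-true (<⇒≤ i<n) = Hom-peak z<s i<n
  ... | no  i≮n rewrite <ᵇ-false (≮⇒≥ i≮n) = Hom-cong (λ σ _ → cong [_] (∧-zeroʳ (isAsc n σ (suc i)))) (Hom-const 0)

  Hom-isValley : ∀ i → Hom (λ σ → [ isValley n σ i ])
  Hom-isValley zero    = Hom-const 0
  Hom-isValley (suc i) with 2 + i <? n
  ... | yes i<n rewrite <ᵇ-true i<n | <ᵇ-true (<⇒≤ i<n) = Hom-valley z<s i<n
  ... | no  i≮n rewrite <ᵇ-false (≮⇒≥ i≮n) = Hom-cong (λ σ _ → cong [_] (∧-zeroʳ (isDes n σ (suc i)))) (Hom-const 0)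

  Hom-isDes-∧ : ∀ i b → Hom (λ σ → [ isDes n σ i ∧ b ])
  Hom-isDes-∧ i true  = Hom-cong (λ σ _ → cong [_] (∧-identityʳ (isDes n σ i))) (Hom-isDes i)
  Hom-isDes-∧ i false = Hom-cong (λ σ _ → cong [_] (∧-zeroʳ (isDes n σ i))) (Hom-const 0)

  -- Statistics summed over all positions

  Hom-inv : Hom (inv n)
  Hom-inv = Hom-Σ 1 n (λ i σ → lehmerAt n σ i) λ i 1≤i i≤n → Hom-code₁ 1≤i i≤n (λ a → a)

  Hom-noninv : Hom (noninv n)
  Hom-noninv = Hom-Σ 1 n _ λ i 1≤i i≤n → Hom-cong (λ σ p → trans (Σ≡∑ (suc i) n _) (above-code p 1≤i))
    (Hom-code₁ 1≤i i≤n (λ a → n ∸ i ∸ a))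

  Hom-invDist≤2 : Hom (invDist≤2 n)
  Hom-invDist≤2 = Hom-Σ 1 n _ λ i 1≤i i≤n → Hom-Σ (suc i) n _ λ j i<j j≤n → step 1≤i j≤n (m≤n⇒∃[o]m+o≡n i<j)
    where
    step : ∀ {i j} → 1 ≤ i → j ≤ n → (∃ λ k → suc i + k ≡ j) → Hom (λ σ → [ (at σ j <ᵇ at σ i) ∧ (j ∸ i <ᵇ 3) ])
    step {i} 1≤i j≤n (k , refl) rewrite trans (cong (_∸ i) (sym (+-suc i k))) (m+n∸m≡n i (suc k)) = go k j≤n
      where
      go : ∀ k → suc i + k ≤ n → Hom (λ σ → [ (at σ (suc i + k) <ᵇ at σ i) ∧ (k <ᵇ 2) ])
      go zero          j≤n rewrite +-identityʳ i =
        Hom-cong (λ σ _ → cong [_] (∧-identityʳ (at σ (suc i) <ᵇ at σ i))) (Hom-descent 1≤i j≤n)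
      go (suc zero)    j≤n rewrite +-comm i 1 =
        Hom-cong (λ σ _ → cong [_] (∧-identityʳ (at σ (2 + i) <ᵇ at σ i))) (Hom-descent2 1≤i j≤n)
      go (suc (suc k)) j≤n =
        Hom-cong (λ σ _ → cong [_] (∧-zeroʳ (at σ (suc i + (2 + k)) <ᵇ at σ i))) (Hom-const 0)

  Hom-invOfEntry : ∀ p → 1 ≤ p → Hom (invOfEntry p n)
  Hom-invOfEntry p 1≤p with p ≤? n
  ... | yes p≤n = Hom-code₁ 1≤p p≤n (λ a → a)
  ... | no  p≰n = Hom-Σ (suc p) n _ λ j p<j j≤n → ⊥-elim (p≰n (≤-trans (<⇒≤ p<j) j≤n))

  Hom-maj : Hom (maj n)
  Hom-maj = Hom-Σ 1 (n ∸ 1) _ λ i _ _ → Hom-* i (Hom-isDes i)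

  Hom-comaj : Hom (comaj n)
  Hom-comaj = Hom-Σ 1 (n ∸ 1) _ λ i _ _ → Hom-* (n ∸ i) (Hom-isDes i)

  Hom-des : Hom (des n)
  Hom-des = Hom-Σ 1 (n ∸ 1) _ λ i _ _ → Hom-isDes i

  Hom-asc : Hom (asc n)
  Hom-asc = Hom-Σ 1 (n ∸ 1) _ λ i _ _ → Hom-isAsc i

  Hom-peaks : Hom (peaks n)
  Hom-peaks = Hom-Σ 1 (n ∸ 1) _ λ i _ _ → Hom-isPeak i

  Hom-valleys : Hom (valleys n)
  Hom-valleys = Hom-Σ 1 (n ∸ 1) _ λ i _ _ → Hom-isValley i

  Hom-oddDes : Hom (oddDes n)
  Hom-oddDes = Hom-Σ 1 (n ∸ 1) _ λ i _ _ → Hom-isDes-∧ i (odd i)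

  Hom-evenDes : Hom (evenDes n)
  Hom-evenDes = Hom-Σ 1 (n ∸ 1) _ λ i _ _ → Hom-isDes-∧ i (not (odd i))

  Hom-doubleAsc : Hom (doubleAsc n)
  Hom-doubleAsc = Hom-Σ 1 (n ∸ 2) _ λ i 1≤i i≤n-2 → Hom-cong
    (λ σ _ → cong₂ (λ j k → [ (at σ i <ᵇ at σ j) ∧ (at σ j <ᵇ at σ k) ]) (+-comm i 1) (+-comm i 2))
    (Hom-doubleAscent 1≤i (m≤n∸2⇒2+m≤n 1≤i i≤n-2))

  Hom-doubleDes : Hom (doubleDes n)
  Hom-doubleDes = Hom-Σ 1 (n ∸ 2) _ λ i 1≤i i≤n-2 → Hom-cong
    (λ σ _ → cong₂ (λ j k → [ (at σ j <ᵇ at σ i) ∧ (at σ k <ᵇ at σ j) ]) (+-comm i 1) (+-comm i 2))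
    (Hom-doubleDescent 1≤i (m≤n∸2⇒2+m≤n 1≤i i≤n-2))

  Hom-desDist2 : Hom (desDist2 n)
  Hom-desDist2 = Hom-Σ 1 (n ∸ 2) _ λ i 1≤i i≤n-2 → Hom-cong
    (λ σ _ → cong (λ k → [ at σ k <ᵇ at σ i ]) (+-comm i 2)) (Hom-descent2 1≤i (m≤n∸2⇒2+m≤n 1≤i i≤n-2))

  Hom-ascDist2 : Hom (ascDist2 n)
  Hom-ascDist2 = Hom-Σ 1 (n ∸ 2) _ λ i 1≤i i≤n-2 → Hom-cong
    (λ σ _ → cong (λ k → [ at σ i <ᵇ at σ k ]) (+-comm i 2)) (Hom-ascent2 1≤i (m≤n∸2⇒2+m≤n 1≤i i≤n-2))

  Hom-runs : Hom (runs n)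
  Hom-runs = Hom-Σ 1 n _ λ { (suc zero) _ _ → Hom-const 1 ; (suc (suc i)) _ _ → Hom-isDes (suc i) }

  -- The adjacent letters give a factor that does not depend on `k`, and the remaining count over
  -- `k` is a `threeCount`; both are functions of two adjacent code entries.
  Hom-vincularAt : ∀ a b c → a ≢ b → a ≢ c → b ≢ c → ∀ i → 1 ≤ i →
    Hom (λ σ → Σ[ 2 + i ⋯ n ] λ k → [ sameOrder a b c (at σ i) (at σ (suc i)) (at σ k) ])
  Hom-vincularAt a b c a≢b a≢c b≢c i 1≤i with suc i ≤? n
  ... | no  i≮n = Hom-Σ (2 + i) n _ λ k i+2≤k k≤n → ⊥-elim (i≮n (≤-trans (<⇒≤ i+2≤k) k≤n))
  ... | yes i<n = Hom-cong
    (λ σ p → trans (Σ≡∑ (2 + i) n _) (trans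
      (∑-cong (n ∸ suc i) λ k k< →
        let j≤n = m<n∸o⇒o+m<n (suc i) n k< in
        trans (cong [_] (sameOrder-distinct a b c a≢b a≢c b≢c
          (IsPerm-distinct p 1≤i ≤-refl i<n)
          (IsPerm-distinct p 1≤i (s≤s (≤-trans (n≤1+n i) (m≤m+n (suc i) k))) j≤n)
          (IsPerm-distinct p z<s (s≤s (m≤m+n (suc i) k)) j≤n)))
          ([]-∧ ((a <ᵇ b) == (at σ i <ᵇ at σ (suc i))) _))
      (trans (∑-*ˡ (n ∸ suc i) [ (a <ᵇ b) == (at σ i <ᵇ at σ (suc i)) ]
               (λ k → [ ((a <ᵇ c) == (at σ i <ᵇ at σ (2 + i + k))) ∧ ((b <ᵇ c) == (at σ (suc i) <ᵇ at σ (2 + i + k))) ]))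
        (cong₂ _*_ (cong (λ d → [ (a <ᵇ b) == d ]) (ascent-code p 1≤i i<n)) (threeCount-code p 1≤i i<n (a <ᵇ c) (b <ᵇ c))))))
    (Hom-code₂ 1≤i i<n λ A B → [ (a <ᵇ b) == not (B <ᵇ A) ] * threeCount (a <ᵇ c) (b <ᵇ c) (n ∸ suc i) A B)

  Hom-vincular : ∀ a b c → a ≢ b → a ≢ c → b ≢ c → Hom (vincularAB-C a b c n)
  Hom-vincular a b c a≢b a≢c b≢c = Hom-Σ 1 n _ λ i 1≤i _ → Hom-cong
    (λ σ _ → cong₂ (λ l j → Σ[ l ⋯ n ] λ k → [ sameOrder a b c (at σ i) (at σ j) (at σ k) ]) (+-comm i 2) (+-comm i 1))
    (Hom-vincularAt a b c a≢b a≢c b≢c i 1≤i)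

  -- For fixed `i`, an occurrence is any two-element set of later positions whose values lie between
  -- σᵢ and σᵢ₊₁; the order of these two values is free.
  Hom-occ14 : Hom (occ14-2-3or14-3-2 n)
  Hom-occ14 = Hom-Σ 1 n _ λ i 1≤i _ → Hom-cong
    (λ σ _ → cong₂ (λ a j → Σ[ a ⋯ n ] λ l → Σ[ suc l ⋯ n ] λ m →
        [ (at σ i <ᵇ at σ l) ∧ (at σ l <ᵇ at σ j) ∧ (at σ i <ᵇ at σ m) ∧ (at σ m <ᵇ at σ j) ])
      (+-comm i 2) (+-comm i 1))
    (at-position i 1≤i)
    where
    at-position : ∀ i → 1 ≤ i → Hom (λ σ → Σ[ 2 + i ⋯ n ] λ l → Σ[ suc l ⋯ n ] λ m →
      [ (at σ i <ᵇ at σ l) ∧ (at σ l <ᵇ at σ (suc i)) ∧ (at σ i <ᵇ at σ m) ∧ (at σ m <ᵇ at σ (suc i)) ])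
    at-position i 1≤i with suc i ≤? n
    ... | no  i≮n = Hom-Σ (2 + i) n _ λ k i+2≤k k≤n → ⊥-elim (i≮n (≤-trans (<⇒≤ i+2≤k) k≤n))
    ... | yes i<n = Hom-cong
      (λ σ p →
        let flip : ∀ k → k < n ∸ suc i → (at σ (2 + i + k) <ᵇ at σ (suc i)) ≡ not (at σ (suc i) <ᵇ at σ (2 + i + k))
            flip k k< = <ᵇ-flip (IsPerm-distinct p z<s (s≤s (m≤m+n (suc i) k)) (m<n∸o⇒o+m<n (suc i) n k<))
        in trans (ΣΣ≡pairs (2 + i) n _) (trans
          (pairs-cong (n ∸ suc i) λ k l k<l l<N → cong [_] (trans
            (sym (∧-assoc (at σ i <ᵇ at σ (2 + i + k)) _ _))
            (cong₂ (λ u v → ((at σ i <ᵇ at σ (2 + i + k)) ∧ u) ∧ ((at σ i <ᵇ at σ (2 + i + l)) ∧ v))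
              (flip k (<-trans k<l l<N)) (flip l l<N))))
          (trans (pairs-both (n ∸ suc i) _) (cong choose₂ (threeCount-code p 1≤i i<n true false)))))
      (Hom-code₂ 1≤i i<n λ A B → choose₂ (threeCount true false (n ∸ suc i) A B))

  -- Two patterns whose union only constrains how the later two entries compare to the first.
  Hom-classical : ∀ a b c a′ b′ c′ (u : Bool → Bool → ℕ) (g : ℕ → ℕ → ℕ) →
    (∀ {x y z} → x ≢ y → x ≢ z → y ≢ z →
      [ sameOrder a b c x y z ] + [ sameOrder a′ b′ c′ x y z ] ≡ u (x <ᵇ y) (x <ᵇ z)) →
    (∀ d (β : ℕ → Bool) → pairs d (λ k l → u (β k) (β l)) ≡ g d (∑ d (λ k → [ β k ]))) →
    Hom (λ σ → classical a b c n σ + classical a′ b′ c′ n σ)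
  Hom-classical a b c a′ b′ c′ u g cover count = Hom-cong (λ σ _ → Σ-+ 1 n _ _) (Hom-Σ 1 n _ λ i 1≤i i≤n → Hom-cong
    (λ σ p → trans (cong₂ _+_ (ΣΣ≡pairs (suc i) n _) (ΣΣ≡pairs (suc i) n _)) (trans (sym (pairs-+ (n ∸ i) (λ k l → [ sameOrder a b c (at σ i) (at σ (suc i + k)) (at σ (suc i + l)) ])
                           (λ k l → [ sameOrder a′ b′ c′ (at σ i) (at σ (suc i + k)) (at σ (suc i + l)) ]))) (trans
      (pairs-cong (n ∸ i) λ k l k<l l<N → cover
        (IsPerm-distinct p 1≤i (s≤s (m≤m+n i k)) (m<n∸o⇒o+m<n i n (<-trans k<l l<N)))
        (IsPerm-distinct p 1≤i (s≤s (m≤m+n i l)) (m<n∸o⇒o+m<n i n l<N))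
        (IsPerm-distinct p z<s (+-monoʳ-< (suc i) k<l) (m<n∸o⇒o+m<n i n l<N)))
      (trans (count (n ∸ i) (λ k → at σ i <ᵇ at σ (suc i + k))) (cong (g (n ∸ i)) (above-code p 1≤i))))))
    (Hom-code₁ 1≤i i≤n (λ a → g (n ∸ i) (n ∸ i ∸ a))))

  Hom-123+132 : Hom (λ σ → classical 1 2 3 n σ + classical 1 3 2 n σ)
  Hom-123+132 = Hom-classical 1 2 3 1 3 2 (λ β β′ → [ β ∧ β′ ]) (λ _ m → choose₂ m)
    (λ {x} {y} {z} xy xz yz → trans
      (cong₂ (λ s t → [ s ] + [ t ]) (sameOrder-distinct 1 2 3 (λ ()) (λ ()) (λ ()) xy xz yz)
                                      (sameOrder-distinct 1 3 2 (λ ()) (λ ()) (λ ()) xy xz yz))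
      (merge (x <ᵇ y) (x <ᵇ z) (y <ᵇ z)))
    pairs-both
    where
    merge : ∀ p q r → [ p ∧ q ∧ r ] + [ p ∧ q ∧ not r ] ≡ [ p ∧ q ]
    merge true  true  true  = refl
    merge true  true  false = refl
    merge true  false r     = refl
    merge false q     r     = refl

  Hom-213+231 : Hom (λ σ → classical 2 1 3 n σ + classical 2 3 1 n σ)
  Hom-213+231 = Hom-classical 2 1 3 2 3 1 (λ β β′ → [ not β ∧ β′ ] + [ β ∧ not β′ ]) (λ d m → m * (d ∸ m))
    (λ {x} {y} {z} xy xz yz → trans
      (cong₂ (λ s t → [ s ] + [ t ]) (sameOrder-distinct 2 1 3 (λ ()) (λ ()) (λ ()) xy xz yz)
                                      (sameOrder-distinct 2 3 1 (λ ()) (λ ()) (λ ()) xy xz yz))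
      (merge (x <ᵇ y) (x <ᵇ z) (y <ᵇ z)
        (λ y≥x x<z → <ᵇ-trans y x z (trans (<ᵇ-flip xy) (cong not y≥x)) x<z)
        (λ x<y x≥z → trans (<ᵇ-flip (yz ∘ sym)) (cong not (<ᵇ-trans z x y (trans (<ᵇ-flip xz) (cong not x≥z)) x<y)))))
    (λ d β → trans (pairs-mixed d β) (cong (∑ d (λ k → [ β k ]) *_) (∑-not d β)))
    where
    merge : ∀ p q r → (p ≡ false → q ≡ true → r ≡ true) → (p ≡ true → q ≡ false → r ≡ false) →
            [ not p ∧ q ∧ r ] + [ p ∧ not q ∧ not r ] ≡ [ not p ∧ q ] + [ p ∧ not q ]
    merge true  true  r _ _ = refl
    merge true  false r _ h rewrite h refl refl = refl
    merge false true  r h _ rewrite h refl refl = refl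
    merge false false r _ _ = refl

  Hom-312+321 : Hom (λ σ → classical 3 1 2 n σ + classical 3 2 1 n σ)
  Hom-312+321 = Hom-classical 3 1 2 3 2 1 (λ β β′ → [ not β ∧ not β′ ]) (λ d m → choose₂ (d ∸ m))
    (λ {x} {y} {z} xy xz yz → trans
      (cong₂ (λ s t → [ s ] + [ t ]) (sameOrder-distinct 3 1 2 (λ ()) (λ ()) (λ ()) xy xz yz)
                                      (sameOrder-distinct 3 2 1 (λ ()) (λ ()) (λ ()) xy xz yz))
      (merge (x <ᵇ y) (x <ᵇ z) (y <ᵇ z)))
    (λ d β → trans (pairs-both d (not ∘ β)) (cong choose₂ (∑-not d β)))
    where
    merge : ∀ p q r → [ not p ∧ not q ∧ r ] + [ not p ∧ not q ∧ not r ] ≡ [ not p ∧ not q ]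
    merge false false true  = refl
    merge false false false = refl
    merge false true  r     = refl
    merge true  q     r     = refl

  private
    -- Since the code entry is at most `n ∸ i`, the double difference equals it: the condition is
    -- that no later entry is smaller.
    minimum-code : ∀ {σ i} → IsPerm n σ → 1 ≤ i →
      All[ suc i ⋯ n ] (λ j → at σ i <ᵇ at σ j) ≡ (n ∸ i ∸ (n ∸ i ∸ lehmerAt n σ i) ≡ᵇ 0)
    minimum-code {σ} {i} p 1≤i = trans (All-∑ (suc i) n _)
      (cong (_≡ᵇ 0) (trans (∑-not (n ∸ i) _) (cong (n ∸ i ∸_) (above-code p 1≤i))))

  Hom-rlMaxima : Hom (rlMaxima n)
  Hom-rlMaxima = Hom-Σ 1 n _ λ i 1≤i i≤n → Hom-cong
    (λ σ _ → cong [_] (trans (All-∑ (suc i) n _)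
      (cong (_≡ᵇ 0) (trans (∑-not (n ∸ i) _) (cong (n ∸ i ∸_) (sym (lehmerAt-∑ n σ i)))))))
    (Hom-code₁ 1≤i i≤n (λ a → [ n ∸ i ∸ a ≡ᵇ 0 ]))

  Hom-rlMinima : Hom (rlMinima n)
  Hom-rlMinima = Hom-Σ 1 n _ λ i 1≤i i≤n → Hom-cong (λ σ p → cong [_] (minimum-code p 1≤i))
    (Hom-code₁ 1≤i i≤n (λ a → [ n ∸ i ∸ (n ∸ i ∸ a) ≡ᵇ 0 ]))

  Hom-specialAscTops : Hom (specialAscTops n)
  Hom-specialAscTops = Hom-Σ 2 n _ λ { (suc i) 2≤i i<n → Hom-cong
    (λ σ p → cong₂ (λ a b → [ a ∧ b ]) (ascent-code p (≤-pred 2≤i) i<n) (minimum-code p z<s))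
    (Hom-code₂ (≤-pred 2≤i) i<n (λ a b → [ not (b <ᵇ a) ∧ (n ∸ suc i ∸ (n ∸ suc i ∸ b) ≡ᵇ 0) ])) }

Unique-++ˡ : ∀ {xs ys : List ℕ} → Unique (xs ++ ys) → Unique xs
Unique-++ˡ {[]}     _            = []
Unique-++ˡ {x ∷ xs} (x∉ ∷ unique) = All.++⁻ˡ xs x∉ ∷ Unique-++ˡ unique

-- The first entry

range-bounds : ∀ n → All (λ v → 1 ≤ v × v ≤ n) (range 1 n)
range-bounds n = All.applyUpTo⁺₁ suc n (λ k<n → z<s , k<n)

IsPerm-bounds : ∀ {n σ} → IsPerm n σ → All (λ v → 1 ≤ v × v ≤ n) σ
IsPerm-bounds {n} p = All-resp-↭ (↭-sym p) (range-bounds n)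

lehmerAt-perm : ∀ {n σ} → IsPerm n σ → ∀ i → i < n → lehmerAt n σ (suc i) ≡ at (code σ) (suc i)
lehmerAt-perm {n} {σ} p i i<n = trans (cong (λ m → lehmerAt m σ (suc i)) (sym (IsPerm-length p)))
  (lehmerAt-code σ i (subst (i <_) (sym (IsPerm-length p)) i<n))

smaller-range : ∀ y n → y < n → smaller (suc y) (range 1 n) ≡ y
smaller-range y n y<n = trans (sum-map-applyUpTo (λ v → [ v <ᵇ suc y ]) suc n)
  (trans (cong (λ N → ∑ N (λ k → [ k <ᵇ y ])) (sym (m+[n∸m]≡n (<⇒≤ y<n)))) (∑-below y (n ∸ y)))

-- Exactly σ₁ - 1 of the values 1, ..., n are smaller than σ₁, and all of them stand after it.
firstEntry-code : ∀ {n σ} → 1 ≤ n → IsPerm n σ → firstEntry n σ ≡ suc (lehmerAt n σ 1)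
firstEntry-code {n} {[]}     1≤n p = ⊥-elim (<⇒≢ 1≤n (IsPerm-length p))
firstEntry-code {n} {x ∷ xs} 1≤n p with IsPerm-bounds p
firstEntry-code {n} {suc y ∷ xs} 1≤n p | (_ , y<n) ∷ _ = cong suc (begin
  y                                     ≡⟨ smaller-range y n y<n ⟨
  smaller (suc y) (range 1 n)           ≡⟨ smaller-↭ {suc y} p ⟨
  [ y <ᵇ y ] + smaller (suc y) xs       ≡⟨ cong (λ b → [ b ] + smaller (suc y) xs) (<ᵇ-false (≤-refl {y})) ⟩
  smaller (suc y) xs                    ≡⟨ lehmerAt-perm p 0 1≤n ⟨
  lehmerAt n (suc y ∷ xs) 1             ∎)
  where open ≡-Reasoning

-- The width of the permutation tree

≡ᵇ-refl : ∀ m → (m ≡ᵇ m) ≡ true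
≡ᵇ-refl zero    = refl
≡ᵇ-refl (suc m) = ≡ᵇ-refl m

≡ᵇ-false : ∀ {m n} → m ≢ n → (m ≡ᵇ n) ≡ false
≡ᵇ-false {zero}  {zero}  m≢n = ⊥-elim (m≢n refl)
≡ᵇ-false {zero}  {suc n} m≢n = refl
≡ᵇ-false {suc m} {zero}  m≢n = refl
≡ᵇ-false {suc m} {suc n} m≢n = ≡ᵇ-false {m} {n} (m≢n ∘ cong suc)

∉ᵇ : ∀ {u xs} → All (u ≢_) xs → (u ∈ᵇ xs) ≡ false
∉ᵇ []             = refl
∉ᵇ (u≢x ∷ u∉xs) rewrite ≡ᵇ-false u≢x = ∉ᵇ u∉xs

sum-map-cong : ∀ {A : Set} {f g : A → ℕ} {xs} → All (λ x → f x ≡ g x) xs → sum (map f xs) ≡ sum (map g xs)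
sum-map-cong []         = refl
sum-map-cong (eq ∷ eqs) = cong₂ _+_ eq (sum-map-cong eqs)

dropGreater-All : ∀ {P : ℕ → Set} v {xs} → All P xs → All P (dropGreater v xs)
dropGreater-All v [] = []
dropGreater-All v {x ∷ xs} (px ∷ pxs) with v <ᵇ x
... | true  = dropGreater-All v pxs
... | false = px ∷ pxs

headOr0-All : ∀ {P : ℕ → Set} {xs} → P 0 → All P xs → P (headOr0 xs)
headOr0-All p₀ []       = p₀
headOr0-All p₀ (px ∷ _) = px

parentsFrom-All : ∀ {P : ℕ → Set} {path vs} → P 0 → All P path → All P vs → All P (parentsFrom path vs)
parentsFrom-All p₀ ps []                 = []
parentsFrom-All p₀ ps (_∷_ {v} pv pvs) =
  headOr0-All p₀ (dropGreater-All v ps) ∷ parentsFrom-All p₀ (pv ∷ dropGreater-All v ps) pvs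

descents : List ℕ → ℕ
descents []           = 0
descents (v ∷ [])     = 0
descents (v ∷ w ∷ ws) = [ w <ᵇ v ] + descents (w ∷ ws)

-- A node becomes a parent only if its immediate successor exceeds it: otherwise it leaves the
-- path at once.
leaves-parentsFrom : ∀ v vs path → Unique (v ∷ vs) → All (λ u → u ≢ 0 × All (u ≢_) path) (v ∷ vs) →
  sum (map (λ u → [ not (u ∈ᵇ parentsFrom (v ∷ path) vs) ]) (v ∷ vs)) ≡ suc (descents (v ∷ vs))
leaves-parentsFrom v []       path _ _ = refl
leaves-parentsFrom v (w ∷ ws) path (v∉ ∷ unique) ((v≢0 , v∉path) ∷ fresh) with w <ᵇ v
... | true  = cong₂ _+_
  (cong (λ b → [ not b ]) (∉ᵇ (headOr0-All v≢0 v∉d ∷ parentsFrom-All v≢0 (All.head v∉ ∷ v∉d) (All.tail v∉))))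
  (trans (sum-map-cong (All.map (λ {u} (u≢0 , u∉path) → cong (λ b → [ not (b ∨ (u ∈ᵇ parentsFrom (w ∷ dropGreater w path) ws)) ])
           (≡ᵇ-false (headOr0-All u≢0 (dropGreater-All w u∉path)))) fresh))
         (leaves-parentsFrom w ws (dropGreater w path) unique
           (All.map (λ (u≢0 , u∉path) → u≢0 , dropGreater-All w u∉path) fresh)))
  where v∉d = dropGreater-All w v∉path
... | false rewrite ≡ᵇ-refl v = trans
  (sum-map-cong (All.zipWith (λ {u} (v≢u , _) → cong (λ b → [ not (b ∨ (u ∈ᵇ parentsFrom (w ∷ v ∷ path) ws)) ])
    (≡ᵇ-false (v≢u ∘ sym))) (v∉ , fresh)))
  (leaves-parentsFrom w ws (v ∷ path) unique
    (All.zipWith (λ (v≢u , u≢0 , u∉path) → u≢0 , (v≢u ∘ sym) ∷ u∉path) (v∉ , fresh)))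

des-descents : ∀ {n σ} → length σ ≡ n → des n σ ≡ descents σ
des-descents {σ = []}     refl = refl
des-descents {σ = v ∷ vs} refl = trans (Σ≡∑ 1 (length vs) _) (trans
  (∑-cong (length vs) λ k k< → cong (λ b → [ b ∧ (at (v ∷ vs) (2 + k) <ᵇ at (v ∷ vs) (suc k)) ]) (<ᵇ-true k<)) (go v vs))
  where
  go : ∀ v vs → ∑ (length vs) (λ k → [ at (v ∷ vs) (2 + k) <ᵇ at (v ∷ vs) (suc k) ]) ≡ descents (v ∷ vs)
  go v []       = refl
  go v (w ∷ ws) = cong ([ w <ᵇ v ] +_) (go w ws)

treeWidth-des : ∀ {n σ} → 1 ≤ n → IsPerm n σ → treeWidth n σ ≡ suc (des n σ)
treeWidth-des {n} {[]}     1≤n p = ⊥-elim (<⇒≢ 1≤n (IsPerm-length p))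
treeWidth-des {n} {x ∷ xs} 1≤n p = begin
  -- The term of the root 0 has already vanished by computation: the root is the parent of the first
  -- entry.
  sum (map leaf (range 1 n))   ≡⟨ sum-↭ (map⁺ leaf p) ⟨
  sum (map leaf (x ∷ xs))      ≡⟨ sum-map-cong (All.map (λ {u} u≢0 → cong (λ b → [ not (b ∨ (u ∈ᵇ parentsFrom (x ∷ 0 ∷ []) xs)) ]) (≡ᵇ-false u≢0)) nonzero) ⟩
  sum (map (λ u → [ not (u ∈ᵇ parentsFrom (x ∷ 0 ∷ []) xs) ]) (x ∷ xs))
                               ≡⟨ leaves-parentsFrom x xs (0 ∷ []) (IsPerm-Unique p) (All.map (λ u≢0 → u≢0 , u≢0 ∷ []) nonzero) ⟩
  suc (descents (x ∷ xs))      ≡⟨ cong suc (des-descents (IsPerm-length p)) ⟨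
  suc (des n (x ∷ xs))         ∎
  where
  open ≡-Reasoning
  leaf : ℕ → ℕ
  leaf u = [ not (u ∈ᵇ treeParents (x ∷ xs)) ]
  nonzero : All (_≢ 0) (x ∷ xs)
  nonzero = All.map (λ (1≤u , _) u≡0 → <⇒≢ 1≤u (sym u≡0)) (IsPerm-bounds p)

-- The lexicographic rank

-- For `ρ = range 1 n` this is the membership test in `isPermᵇ`; a general `ρ` lets inductions
-- remove one letter at a time.
covers : List ℕ → List ℕ → Bool
covers ρ τ = foldr (λ v r → (v ∈ᵇ τ) ∧ r) true ρ

covers-↭ : ∀ {ρ ρ′} → ρ ↭ ρ′ → ∀ τ → covers ρ τ ≡ covers ρ′ τ
covers-↭ p τ = go p
  where
  swap-∧ : ∀ a b c → a ∧ b ∧ c ≡ b ∧ a ∧ c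
  swap-∧ true  b     c = refl
  swap-∧ false true  c = refl
  swap-∧ false false c = refl
  go : ∀ {ρ ρ′} → ρ ↭ ρ′ → covers ρ τ ≡ covers ρ′ τ
  go ↭.refl         = refl
  go (↭.prep x p)   = cong ((x ∈ᵇ τ) ∧_) (go p)
  go (↭.swap x y p) = trans (swap-∧ (x ∈ᵇ τ) (y ∈ᵇ τ) _) (cong (λ r → (y ∈ᵇ τ) ∧ (x ∈ᵇ τ) ∧ r) (go p))
  go (↭.trans p q)  = trans (go p) (go q)

covers-∷-fresh : ∀ {v ρ} τ → All (v ≢_) ρ → covers ρ (v ∷ τ) ≡ covers ρ τ
covers-∷-fresh τ [] = refl
covers-∷-fresh τ (_∷_ {u} v≢u v∉ρ) rewrite ≡ᵇ-false (v≢u ∘ sym) = cong ((u ∈ᵇ τ) ∧_) (covers-∷-fresh τ v∉ρ)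

covers-∷ : ∀ {v ρ} τ → All (v ≢_) ρ → covers (v ∷ ρ) (v ∷ τ) ≡ covers ρ τ
covers-∷ {v} τ v∉ρ rewrite ≡ᵇ-refl v = covers-∷-fresh τ v∉ρ

extract : ∀ {v : ℕ} {ρ} → v ∈ ρ → ∃ λ ρ′ → ρ ↭ v ∷ ρ′
extract v∈ρ with as , bs , refl ← ∈-∃++ v∈ρ = as ++ bs , shift _ as bs

-- The head of `τ` accounts for at most one letter of `ρ`; removing both keeps `ρ` the longer list.
covers-pigeonhole : ∀ τ ρ → Unique ρ → length τ < length ρ → covers ρ τ ≡ false
covers-pigeonhole []      (u ∷ ρ) _ _ = refl
covers-pigeonhole (v ∷ τ) ρ unique τ<ρ with v ∈? ρ
... | no  v∉ρ = trans (covers-∷-fresh τ (All.¬Any⇒All¬ ρ v∉ρ)) (covers-pigeonhole τ ρ unique (<⇒≤ τ<ρ))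
... | yes v∈ρ with ρ′ , p ← extract v∈ρ with v∉ρ′ ∷ unique′ ← Unique-↭ p unique =
  trans (covers-↭ p (v ∷ τ)) (trans (covers-∷ τ v∉ρ′)
    (covers-pigeonhole τ ρ′ unique′ (s<s⁻¹ (subst (length (v ∷ τ) <_) (↭-length p) τ<ρ))))

sum-map-const : ∀ {A : Set} {f : A → ℕ} {c xs} → All (λ x → f x ≡ c) xs → sum (map f xs) ≡ length xs * c
sum-map-const []         = refl
sum-map-const (eq ∷ eqs) = cong₂ _+_ eq (sum-map-const eqs)

sum-map-zero : ∀ {A : Set} {f : A → ℕ} {xs} → All (λ x → f x ≡ 0) xs → sum (map f xs) ≡ 0
sum-map-zero {xs = xs} eqs = trans (sum-map-const eqs) (*-zeroʳ (length xs))

allLists-length : ∀ n k → All (λ τ → length τ ≡ k) (allLists n k)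
allLists-length n zero    = refl ∷ []
allLists-length n (suc k) = All.concat⁺ (All.map⁺ (All.universal
  (λ v → All.map⁺ (All.map (cong suc) (allLists-length n k))) (range 1 n)))

sum-allLists : ∀ n k (F : List ℕ → ℕ) →
  sum (map F (allLists n (suc k))) ≡ sum (map (λ v → sum (map (λ τ → F (v ∷ τ)) (allLists n k))) (range 1 n))
sum-allLists n k F = go (range 1 n)
  where
  go : ∀ vs → sum (map F (concatMap (λ v → map (v ∷_) (allLists n k)) vs))
            ≡ sum (map (λ v → sum (map (λ τ → F (v ∷ τ)) (allLists n k))) vs)
  go []       = refl
  go (v ∷ vs) = trans (cong sum (map-++ F (map (v ∷_) (allLists n k)) _))
    (trans (sum-++ (map F (map (v ∷_) (allLists n k))) _)
      (cong₂ _+_ (cong sum (sym (map-∘ (allLists n k)))) (go vs)))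

module _ (n : ℕ) where

  private
    uncovered : ∀ {v ρ} k → Unique ρ → All (v ≢_) ρ → length ρ ≡ suc k →
      All (λ τ → covers ρ (v ∷ τ) ≡ false) (allLists n k)
    uncovered {ρ = ρ} k unique v∉ρ eq = All.map
      (λ {τ} len → trans (covers-∷-fresh τ v∉ρ) (covers-pigeonhole τ ρ unique (≤-reflexive (trans (cong suc len) (sym eq)))))
      (allLists-length n k)

    disjoint : ∀ {v : ℕ} {xs ys : List ℕ} → Unique (xs ++ ys) → v ∈ ys → All (v ≢_) xs
    disjoint {xs = []}     unique       v∈ys = []
    disjoint {xs = x ∷ xs} (x∉ ∷ unique) v∈ys =
      (λ v≡x → All.lookup (All.++⁻ʳ xs x∉) v∈ys (sym v≡x)) ∷ disjoint unique v∈ys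

    move : ∀ {v : ℕ} {ρ ρ′ κ R : List ℕ} → R ↭ ρ ++ κ → ρ ↭ v ∷ ρ′ → R ↭ ρ′ ++ v ∷ κ
    move {v} {ρ} {ρ′} {κ} p q = ↭-trans p (↭-trans (++⁺ʳ κ q) (↭-sym (shift v ρ′ κ)))

  -- ρ is completed by κ to a rearrangement of 1, …, n.
  count-arrangements : ∀ k ρ κ → range 1 n ↭ ρ ++ κ → Unique (ρ ++ κ) → length ρ ≡ k →
    sum (map (λ τ → [ covers ρ τ ]) (allLists n k)) ≡ k !
  count-arrangements zero    [] κ _ _ _ = refl
  count-arrangements (suc k) ρ κ p unique len = begin
    sum (map (λ τ → [ covers ρ τ ]) (allLists n (suc k)))  ≡⟨ sum-allLists n k _ ⟩
    sum (map G (range 1 n))                                ≡⟨ sum-↭ (map⁺ G p) ⟩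
    sum (map G (ρ ++ κ))                                   ≡⟨ trans (cong sum (map-++ G ρ κ)) (sum-++ (map G ρ) (map G κ)) ⟩
    sum (map G ρ) + sum (map G κ)                          ≡⟨ cong₂ _+_ (sum-map-const (All.tabulate used)) (sum-map-zero (All.tabulate unused)) ⟩
    length ρ * k ! + 0                                     ≡⟨ +-identityʳ _ ⟩
    length ρ * k !                                         ≡⟨ cong (_* k !) len ⟩
    suc k * k !                                            ∎
    where
    open ≡-Reasoning
    G : ℕ → ℕ
    G v = sum (map (λ τ → [ covers ρ (v ∷ τ) ]) (allLists n k))
    used : ∀ {v} → v ∈ ρ → G v ≡ k !
    used {v} v∈ρ with ρ′ , q ← extract v∈ρ with v∉ρ′ ∷ _ ← Unique-↭ q (Unique-++ˡ unique) = trans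
      (sum-map-cong (All.universal (λ τ → cong [_] (trans (covers-↭ q (v ∷ τ)) (covers-∷ τ v∉ρ′))) (allLists n k)))
      (count-arrangements k ρ′ (v ∷ κ) (move p q) (Unique-↭ (↭-trans (↭-sym p) (move p q)) unique)
        (suc-injective (trans (sym (↭-length q)) len)))
    unused : ∀ {v} → v ∈ κ → G v ≡ 0
    unused v∈κ = sum-map-zero (All.map (cong [_]) (uncovered k (Unique-++ˡ unique) (disjoint unique v∈κ) len))

  -- The code read in the factorial number system, plus one because ranks start at 1.
  lexRank : List ℕ → ℕ
  lexRank []       = 1
  lexRank (x ∷ xs) = lexRank xs + smaller x xs * length xs !

  -- The words are sorted by first letter: `x` itself leads to the tail, each smaller letter of `xs`
  -- admits all `k !` arrangements, a larger one none. A letter of `κ` is already spent, and the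
  -- rest is too short to cover `σ`.
  count-lexLeq : ∀ k σ κ → range 1 n ↭ σ ++ κ → Unique (σ ++ κ) → length σ ≡ k →
    sum (map (λ τ → [ covers σ τ ∧ lexLeq τ σ ]) (allLists n k)) ≡ lexRank σ
  count-lexLeq zero    []       κ _ _ _ = refl
  count-lexLeq (suc k) (x ∷ xs) κ p unique@(x∉ ∷ unique′) len = begin
    sum (map (λ τ → [ covers (x ∷ xs) τ ∧ lexLeq τ (x ∷ xs) ]) (allLists n (suc k))) ≡⟨ sum-allLists n k _ ⟩
    sum (map H (range 1 n))                     ≡⟨ sum-↭ (map⁺ H p) ⟩
    H x + sum (map H (xs ++ κ))                 ≡⟨ cong (H x +_) (trans (cong sum (map-++ H xs κ)) (sum-++ (map H xs) (map H κ))) ⟩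
    H x + (sum (map H xs) + sum (map H κ))      ≡⟨ cong₂ _+_ equal (cong₂ _+_ (trans (sum-map-cong (All.tabulate used)) (factor xs)) (sum-map-zero (All.tabulate unused))) ⟩
    lexRank xs + (smaller x xs * k ! + 0)       ≡⟨ cong (lexRank xs +_) (+-identityʳ _) ⟩
    lexRank xs + smaller x xs * k !             ≡⟨ cong (λ m → lexRank xs + smaller x xs * m !) (suc-injective len) ⟨
    lexRank xs + smaller x xs * length xs !     ∎
    where
    open ≡-Reasoning
    H : ℕ → ℕ
    H v = sum (map (λ τ → [ covers (x ∷ xs) (v ∷ τ) ∧ lexLeq (v ∷ τ) (x ∷ xs) ]) (allLists n k))
    factor : ∀ ys → sum (map (λ v → [ v <ᵇ x ] * k !) ys) ≡ smaller x ys * k !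
    factor []       = refl
    factor (y ∷ ys) = trans (cong ([ y <ᵇ x ] * k ! +_) (factor ys)) (sym (*-distribʳ-+ (k !) [ y <ᵇ x ] (smaller x ys)))
    equal : H x ≡ lexRank xs
    equal = trans
      (sum-map-cong (All.universal (λ τ → cong₂ (λ a b → [ a ∧ b ]) (covers-∷ τ (All.++⁻ˡ xs x∉))
        (cong₂ (λ a b → a ∨ (b ∧ lexLeq τ xs)) (<ᵇ-false (≤-refl {x})) (≡ᵇ-refl x))) (allLists n k)))
      (count-lexLeq k xs (x ∷ κ) (move p ↭-refl) (Unique-↭ (↭-sym (shift x xs κ)) unique) (suc-injective len))
    used : ∀ {v} → v ∈ xs → H v ≡ [ v <ᵇ x ] * k !
    used {v} v∈xs with v <ᵇ x
    ... | true with ρ′ , q ← extract (there {x = x} v∈xs) with v∉ρ′ ∷ _ ← Unique-↭ q (Unique-++ˡ unique) = trans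
      (sum-map-cong (All.universal (λ τ → cong [_] (trans (∧-identityʳ _) (trans (covers-↭ q (v ∷ τ)) (covers-∷ τ v∉ρ′)))) (allLists n k)))
      (trans (count-arrangements k ρ′ (v ∷ κ) (move p q) (Unique-↭ (↭-trans (↭-sym p) (move p q)) unique)
        (suc-injective (trans (sym (↭-length q)) len))) (sym (+-identityʳ (k !))))
    ... | false rewrite ≡ᵇ-false {v} {x} (λ v≡x → All.lookup (All.++⁻ˡ xs x∉) v∈xs (sym v≡x)) =
      sum-map-zero (All.universal (λ τ → cong [_] (∧-zeroʳ _)) (allLists n k))
    unused : ∀ {v} → v ∈ κ → H v ≡ 0
    unused {v} v∈κ = sum-map-zero (All.map (λ {τ} eq → cong (λ b → [ b ∧ lexLeq (v ∷ τ) (x ∷ xs) ]) eq)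
      (uncovered k (Unique-++ˡ unique) (disjoint unique v∈κ) len))

  rank-lexRank : ∀ {σ} → IsPerm n σ → rank n σ ≡ lexRank σ
  rank-lexRank {σ} p = trans
    (sum-map-cong (All.map (λ {τ} len → cong (λ b → [ b ∧ lexLeq τ σ ])
      (trans (cong (λ b → b ∧ covers (range 1 n) τ) (trans (cong (_≡ᵇ n) len) (≡ᵇ-refl n))) (covers-↭ (↭-sym p) τ)))
      (allLists-length n n)))
    (count-lexLeq n σ [] (subst (range 1 n ↭_) (sym (++-identityʳ σ)) (↭-sym p))
      (subst Unique (sym (++-identityʳ σ)) (IsPerm-Unique p)) (IsPerm-length p))

  lexRank-∑ : ∀ σ → lexRank σ ≡ ∑ (length σ) (λ k → at (code σ) (suc k) * (length σ ∸ suc k) !) + 1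
  lexRank-∑ []       = refl
  lexRank-∑ (x ∷ xs) = trans (+-comm (lexRank xs) _)
    (trans (cong (smaller x xs * length xs ! +_) (lexRank-∑ xs)) (sym (+-assoc (smaller x xs * length xs !) _ 1)))

  rank-code : ∀ {σ} → IsPerm n σ → rank n σ ≡ ∑ n (λ k → lehmerAt n σ (suc k) * (n ∸ suc k) !) + 1
  rank-code {σ} p = trans (rank-lexRank p) (trans (lexRank-∑ σ) (cong (_+ 1)
    (trans (cong (λ m → ∑ m (λ k → at (code σ) (suc k) * (m ∸ suc k) !)) (IsPerm-length p))
      (∑-cong n λ k k<n → cong (_* (n ∸ suc k) !) (sym (lehmerAt-perm p k k<n))))))

  open Rotation n

  Hom-rank : Hom (rank n)
  Hom-rank = Hom-cong (λ _ → rank-code) (Hom-+ (Hom-∑ n _ λ k k<n → Hom-code₁ z<s k<n (λ a → a * (n ∸ suc k) !)) (Hom-const 1))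

  Hom-firstEntry : 1 ≤ n → Hom (firstEntry n)
  Hom-firstEntry 1≤n = Hom-cong (λ _ → firstEntry-code 1≤n) (Hom-code₁ ≤-refl 1≤n suc)

  Hom-treeWidth : 1 ≤ n → Hom (treeWidth n)
  Hom-treeWidth 1≤n = Hom-cong (λ _ → treeWidth-des 1≤n) (Hom-+ (Hom-const 1) (Hom-des n))

-- The list of all statistics

module _ (n : ℕ) (1≤n : 1 ≤ n) where

  open Rotation n

  private
    homomesic : (f : Stat) → Hom (f n) → Homomesic n (ι f)
    homomesic f hf = Hom⇒Homomesic (ι f) (λ σ → sym (ℤ.+-identityʳ (↑ f n σ))) hf (Hom-const 0)

    vincular : ∀ a b c {a≢b : False (a ≟ b)} {a≢c : False (a ≟ c)} {b≢c : False (b ≟ c)} → Hom (vincularAB-C a b c n)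
    vincular a b c {a≢b} {a≢c} {b≢c} = Hom-vincular n a b c (toWitnessFalse a≢b) (toWitnessFalse a≢c) (toWitnessFalse b≢c)

  statistics-homomesic : Vec.All (Homomesic n) statistics
  statistics-homomesic =
    homomesic inv (Hom-inv n) ∷
    homomesic noninv (Hom-noninv n) ∷
    homomesic invDist≤2 (Hom-invDist≤2 n) ∷
    homomesic (invOfEntry 3) (Hom-invOfEntry n 3 z<s) ∷
    homomesic (invOfEntry 2) (Hom-invOfEntry n 2 z<s) ∷
    homomesic maj (Hom-maj n) ∷
    homomesic des (Hom-des n) ∷
    homomesic peaks (Hom-peaks n) ∷
    homomesic leftOuterPeaks (Hom-+ (Hom-peaks n) (Hom-isDes n 1)) ∷
    homomesic outerPeaks (Hom-+ (Hom-+ (Hom-peaks n) (Hom-isDes n 1)) (Hom-isAsc n (n ∸ 1))) ∷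
    homomesic valleysBoundary (Hom-+ (Hom-+ (Hom-valleys n) (Hom-isAsc n 1)) (Hom-isDes n (n ∸ 1))) ∷
    homomesic asc (Hom-asc n) ∷
    homomesic valleys (Hom-valleys n) ∷
    homomesic doubleAsc (Hom-doubleAsc n) ∷
    homomesic doubleDes (Hom-doubleDes n) ∷
    homomesic runs (Hom-runs n) ∷
    homomesic switches (Hom-+ (Hom-peaks n) (Hom-valleys n)) ∷
    homomesic upDownRuns (Hom-+ (Hom-+ (Hom-+ (Hom-const 1) (Hom-peaks n)) (Hom-valleys n)) (Hom-isDes n 1)) ∷
    homomesic comaj (Hom-comaj n) ∷
    homomesic rightOuterPeaks (Hom-+ (Hom-peaks n) (Hom-isAsc n (n ∸ 1))) ∷
    homomesic desDist2 (Hom-desDist2 n) ∷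
    homomesic ascDist2 (Hom-ascDist2 n) ∷
    homomesic oddDes (Hom-oddDes n) ∷
    homomesic evenDes (Hom-evenDes n) ∷
    homomesic (vincularAB-C 2 1 3) (vincular 2 1 3) ∷
    homomesic (vincularAB-C 1 3 2) (vincular 1 3 2) ∷
    homomesic (vincularAB-C 1 2 3) (vincular 1 2 3) ∷
    homomesic (vincularAB-C 3 1 2) (vincular 3 1 2) ∷
    homomesic (vincularAB-C 2 3 1) (vincular 2 3 1) ∷
    homomesic (vincularAB-C 3 2 1) (vincular 3 2 1) ∷
    homomesic (λ n σ → classical 1 2 3 n σ + classical 1 3 2 n σ) (Hom-123+132 n) ∷
    homomesic (λ n σ → classical 2 1 3 n σ + classical 2 3 1 n σ) (Hom-213+231 n) ∷
    homomesic (λ n σ → classical 3 1 2 n σ + classical 3 2 1 n σ) (Hom-312+321 n) ∷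
    homomesic occ14-2-3or14-3-2 (Hom-occ14 n) ∷
    homomesic occ|1-23 (Hom-vincularAt n 1 2 3 (λ ()) (λ ()) (λ ()) 1 ≤-refl) ∷
    homomesic rlMaxima (Hom-rlMaxima n) ∷
    homomesic rank (Hom-rank n) ∷
    homomesic firstEntry (Hom-firstEntry n 1≤n) ∷
    homomesic treeWidth (Hom-treeWidth n 1≤n) ∷
    homomesic bsStat (Hom-+ (Hom-+ (Hom-+ (vincular 1 3 2) (vincular 2 1 3)) (vincular 3 2 1)) (Hom-des n)) ∷
    homomesic bsStat' (Hom-+ (Hom-+ (Hom-+ (vincular 1 3 2) (vincular 3 1 2)) (vincular 3 2 1)) (Hom-des n)) ∷
    homomesic rlMinima (Hom-rlMinima n) ∷
    Hom⇒Homomesic (λ n σ → ↑ maj n σ ℤ.- ↑ inv n σ) (λ _ → refl) (Hom-maj n) (Hom-inv n) ∷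
    homomesic (λ n σ → inv n σ + maj n σ) (Hom-+ (Hom-inv n) (Hom-maj n)) ∷
    homomesic specialAscTops (Hom-specialAscTops n) ∷ []

theorem4p6 : (n : ℕ) → 1 ≤ n → (k : Fin 45) → Homomesic n (lookup statistics k)
theorem4p6 n 1≤n k = Vec.lookup⁺ (statistics-homomesic n 1≤n) k
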